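{- Let $d\geq 3$ be a natural number. Let $(\mathbb{N},\mathcal{E})$ be a non-amenable coarse space of bounded geometry. Assume that there exists a highly computable symmetric entourage $E\in\mathcal{E}$ such that for every finite $F\subseteq\mathbb{N}$ we have $|E[F]|\geq (d+2)|F|$. Then there exists a computable $E'\in\mathcal{E}$ such that the graph $\Gamma(E')$ is a $d$-regular forest. Moreover, there exists an algorithm which, for any $m,n\in\mathbb{N}$, recognizes whether $m$ and $n$ are in the same connected component of $\Gamma(E')$.
   Context: For a relation $E\subseteq X\times X$, $x\in X$ and $A\subseteq X$, put $E[x]:=\{y\in X : (x,y)\in E\}$ and $E[A]:=\bigcup_{x\in A}E[x]$. A coarse space is a pair $(X,\mathcal{E})$ where $X$ is a set and $\mathcal{E}$ is a collection of subsets of $X\times X$ (called entourages) such that: the diagonal $\Delta_X\in\mathcal{E}$; if $F\subseteq E\in\mathcal{E}$ then $F\in\mathcal{E}$; if $E,F\in\mathcal{E}$ then $E\cup F,\ E^{ -1},\ E\circ F\in\mathcal{E}$. It has bounded geometry if for each $E\in\mathcal{E}$ and every $x\in X$ the set $E[x]$ is finite. A coarse space $(X,\mathcal{E})$ of bounded geometry is amenable if for every $\theta>1$ and every $E\in\mathcal{E}$ there is a non-empty finite $F\subseteq X$ with $|E[F]|\leq\theta|F|$; otherwise it is non-amenable. For $E\subseteq \mathbb{N}\times\mathbb{N}$, $\Gamma(E)$ denotes the graph with vertex set $\mathbb{N}$ and edge relation $E$; when speaking of regularity, forests and connected components it is regarded as an undirected graph, $m$ and $n$ being adjacent iff $(m,n)\in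 E$ or $(n,m)\in E$. A $d$-regular forest is an acyclic graph in which every vertex has exactly $d$ neighbours. A relation $E\subseteq\mathbb{N}\times\mathbb{N}$ is computable if it is a computable set of pairs; a symmetric relation $E$ is highly computable if it is computable, every $E[n]$ is finite, and the function $n\mapsto |E[n]|$ is computable. -}

module Defs where

open import Data.Bool.Base using (if_then_else_)
open import Data.Fin.Base using (Fin)
open import Data.Integer.Base using (+_)
open import Data.List.Base as List using (List; length; _∷ʳ_)
open import Data.List.Membership.Propositional using () renaming (_∈_ to _∈ˡ_)
open import Data.List.Relation.Unary.Linked using (Linked)
open import Data.List.Relation.Unary.Unique.Propositional using (Unique)
open import Data.Nat.Base using (ℕ; zero; suc; _<_)
open import Data.Product.Base using (Σ-syntax; ∃; ∃-syntax; _×_)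
open import Data.Rational.Base as ℚ using (ℚ; 1ℚ)
open import Data.Sum.Base using (_⊎_)
open import Data.Vec.Base using (Vec; []; _∷_; lookup)
open import Data.Vec.Relation.Binary.Pointwise.Inductive using (Pointwise)
open import Function.Base using (flip)
open import Function.Bundles using (_⇔_)
open import Level using (Level; 0ℓ)
import Level
open import Relation.Binary.Construct.Closure.Symmetric using (SymClosure)
open import Relation.Binary.Construct.Composition using (_;_)
open import Relation.Binary.Construct.Union using (_∪_)
open import Relation.Binary.Core using (Rel; _⇒_)
open import Relation.Binary.Definitions using (Decidable)
open import Relation.Binary.PropositionalEquality.Core using (_≡_; _≢_)
open import Relation.Nullary using (¬_; does)
open import Relation.Unary using (Pred; _∈_; _⊆_; _≐_; Satisfiable)

infix 4 _HasSize_ _[_]⇓_ _≤ℝ_·_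
infix 9 _[_]

-- Subsets of X are predicates; E[x] is the partial application E x.

_HasSize_ : {X : Set} → Pred X 0ℓ → ℕ → Set
A HasSize n = ∃[ xs ] Unique xs × A ≐ (_∈ˡ xs) × length xs ≡ n

-- Contained in a finite list.  Classically this is the same as
-- ∃[ n ] A HasSize n.  An exact enumeration of A here would make
-- BoundedGeometry on an inhabited set imply excluded middle, since
-- entourages are closed under arbitrary subrelations.
Finite : {X : Set} → Pred X 0ℓ → Set
Finite A = ∃[ xs ] A ⊆ (_∈ˡ xs)

_[_] : {X : Set} → Rel X 0ℓ → Pred X 0ℓ → Pred X 0ℓ
(E [ A ]) y = ∃[ x ] x ∈ A × E x y

-- Real numbers as two-sided Dedekind cuts.
record ℝ : Set₁ where
  field
    lower upper     : Pred ℚ 0ℓ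
    lower-inhabited : Satisfiable lower
    upper-inhabited : Satisfiable upper
    lower-rounded   : ∀ q → q ∈ lower ⇔ (∃[ r ] q ℚ.< r × r ∈ lower)
    upper-rounded   : ∀ q → q ∈ upper ⇔ (∃[ r ] r ℚ.< q × r ∈ upper)
    disjoint        : ∀ q → ¬ (q ∈ lower × q ∈ upper)
    located         : ∀ {q r} → q ℚ.< r → q ∈ lower ⊎ r ∈ upper

1<ℝ_ : ℝ → Set
1<ℝ θ = 1ℚ ∈ ℝ.lower θ

-- n ≤ θ k, expressed as n ≤ q k for all rationals q > θ.
_≤ℝ_·_ : ℕ → ℝ → ℕ → Set
n ≤ℝ θ · k = ∀ q → q ∈ ℝ.upper θ → (+ n ℚ./ 1) ℚ.≤ q ℚ.* (+ k ℚ./ 1)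

record CoarseStructure (X : Set) (ℓ : Level) : Set (Level.suc 0ℓ Level.⊔ Level.suc ℓ) where
  field
    Entourage : Pred (Rel X 0ℓ) ℓ
    diagonal  : Entourage _≡_
    subset    : ∀ {E F} → F ⇒ E → Entourage E → Entourage F
    union     : ∀ {E F} → Entourage E → Entourage F → Entourage (E ∪ F)
    inverse   : ∀ {E} → Entourage E → Entourage (flip E)
    compose   : ∀ {E F} → Entourage E → Entourage F → Entourage (E ; F)

module _ {X : Set} {ℓ : Level} (𝓔 : CoarseStructure X ℓ) where
  open CoarseStructure 𝓔

  BoundedGeometry : Set (Level.suc 0ℓ Level.⊔ ℓ)
  BoundedGeometry = ∀ E → Entourage E → ∀ x → Finite (E x)

  Amenable : Set (Level.suc 0ℓ Level.⊔ ℓ)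
  Amenable =
    ∀ θ → 1<ℝ θ → ∀ E → Entourage E →
    Σ[ F ∈ Pred X 0ℓ ] Satisfiable F ×
      (∃[ k ] ∃[ n ] F HasSize k × (E [ F ]) HasSize n × n ≤ℝ θ · k)

  NonAmenable : Set (Level.suc 0ℓ Level.⊔ ℓ)
  NonAmenable = ¬ Amenable

-- Kleene's partial recursive functions: Code n denotes n-ary ones.
data Code : ℕ → Set where
  zero    : Code 0
  succ    : Code 1
  proj    : ∀ {n} → Fin n → Code n
  comp    : ∀ {m n} → Code m → Vec (Code n) m → Code n
  primrec : ∀ {n} → Code n → Code (suc (suc n)) → Code (suc n)
  μ       : ∀ {n} → Code (suc n) → Code n

-- c [ xs ]⇓ y : the computation of c on input xs halts with output y.
data _[_]⇓_ : ∀ {n} → Code n → Vec ℕ n → ℕ → Set where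
  ⇓zero : zero [ [] ]⇓ 0
  ⇓succ : ∀ {x} → succ [ x ∷ [] ]⇓ suc x
  ⇓proj : ∀ {n} {i : Fin n} {xs} → proj i [ xs ]⇓ lookup xs i
  ⇓comp : ∀ {m n} {f : Code m} {gs : Vec (Code n) m} {xs ys z} →
          Pointwise (λ g y → g [ xs ]⇓ y) gs ys →
          f [ ys ]⇓ z →
          comp f gs [ xs ]⇓ z
  ⇓primrec-zero : ∀ {n} {f : Code n} {g xs y} →
          f [ xs ]⇓ y →
          primrec f g [ 0 ∷ xs ]⇓ y
  ⇓primrec-suc : ∀ {n} {f : Code n} {g k xs y z} →
          primrec f g [ k ∷ xs ]⇓ y →
          g [ k ∷ y ∷ xs ]⇓ z →
          primrec f g [ suc k ∷ xs ]⇓ z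
  ⇓μ    : ∀ {n} {f : Code (suc n)} {xs y} →
          f [ y ∷ xs ]⇓ 0 →
          (∀ z → z < y → ∃[ k ] f [ z ∷ xs ]⇓ suc k) →
          μ f [ xs ]⇓ y

ComputableFunction : (ℕ → ℕ) → Set
ComputableFunction f = ∃[ c ] ∀ n → c [ n ∷ [] ]⇓ f n

record ComputableRelation (R : Rel ℕ 0ℓ) : Set where
  field
    decide   : Decidable R
    code     : Code 2
    computes : ∀ m n → code [ m ∷ n ∷ [] ]⇓ (if does (decide m n) then 1 else 0)

record HighlyComputable (E : Rel ℕ 0ℓ) : Set where
  field
    computable      : ComputableRelation E
    size            : ℕ → ℕ
    size-correct    : ∀ n → E n HasSize size n
    size-computable : ComputableFunction size

-- The graph Γ(E) has adjacency relation SymClosure E, and its connected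
-- components are the classes of EqClosure E, the relation "joined by a path".

-- A cycle is a closed walk through distinct vertices x ∷ xs.  A loop is a
-- cycle with one vertex; a closed walk with two vertices only traverses a
-- single undirected edge back and forth, so it is not a cycle.
Acyclic : Rel ℕ 0ℓ → Set
Acyclic E =
  ∀ x xs → Unique (x List.∷ xs) → length (x List.∷ xs) ≢ 2 →
  ¬ Linked (SymClosure E) ((x List.∷ xs) ∷ʳ x)

RegularForest : ℕ → Rel ℕ 0ℓ → Set
RegularForest d E = Acyclic E × (∀ n → SymClosure E n HasSize d)

{-# OPTIONS --safe #-}

-- Write D = d + 2.  Since (d + 2)² ≥ 2 D, an effective form of Hall's theorem
-- gives every vertex u a set of D children in (E ∘ E)[u], disjoint for distinct
-- u: children are chosen one at a time, keeping Hall's condition true, and by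
-- expansion the condition can be violated only within a computable distance.
--
-- The graph of the resulting partial parent function may contain cycles and
-- infinite ascending walks.  At stage n we follow the walk from n upwards and
-- cut the edge above the first vertex whose parent has no cut child yet, unless
-- the walk first meets a root, an earlier cut or a vertex below n; if n + 1
-- steps do not decide, the walk has run into a cycle, which is cut instead.  A vertex thus loses at most two of
-- its D children, and after the cuts every ascending walk is finite.  Going
-- down from the roots we drop further children until a root has d children and
-- every other vertex has d - 1.  Components are compared by computing roots.
module Submission where

open import Data.Bool.Base using (Bool; true; false; not; _∧_; _∨_; if_then_else_; T)
open import Data.Bool.Properties using (∧-conicalˡ; ∧-conicalʳ; not-injective; ¬-not; not-involutive; ∨-identityʳ)
open import Data.Empty using (⊥; ⊥-elim)
open import Data.Fin.Base using (Fin; zero; suc; toℕ; fromℕ<)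
open import Data.Fin.Properties using (pigeonhole; toℕ<n; fromℕ<-injective)
open import Data.List.Base using (List; []; _∷_; _∷ʳ_; _++_; length)
open import Data.List.Membership.Propositional using (_∈_)
open import Data.List.Membership.Propositional.Properties using (∈-∃++; ∈-++⁻; ∈-++⁺ˡ; ∈-++⁺ʳ)
open import Data.List.Properties using (length-++)
open import Data.List.Relation.Unary.All as All using (All; []; _∷_)
open import Data.List.Relation.Unary.AllPairs using ([]; _∷_)
open import Data.List.Relation.Unary.Any using (here; there)
open import Data.List.Relation.Unary.Linked using (Linked; _∷_)
open import Data.List.Relation.Unary.Unique.Propositional using (Unique)
open import Data.Nat.Base
open import Data.Nat.DivMod
open import Data.Nat.Divisibility using (divides-refl)
open import Data.Nat.Induction using (<-rec)
import Data.Nat.ListAction as ListAction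
open import Data.Nat.Properties
open import Data.Product.Base using (∃-syntax; Σ-syntax; _×_; _,_; proj₁; proj₂)
open import Data.Sum.Base using (_⊎_; inj₁; inj₂; [_,_]′)
open import Data.Unit.Base using (⊤; tt)
open import Data.Vec.Base using (Vec; []; _∷_; lookup)
open import Data.Vec.Relation.Binary.Pointwise.Inductive using (Pointwise; []; _∷_)
open import Defs
open import Function.Base using (_∘_; id)
open import Level using (Level; 0ℓ)
open import Relation.Binary.Construct.Closure.Equivalence using (EqClosure) renaming (symmetric to EqClosure-sym)
open import Relation.Binary.Construct.Closure.ReflexiveTransitive using (ε; _◅_; _◅◅_)
open import Relation.Binary.Construct.Closure.Symmetric using (SymClosure; fwd; bwd)
open import Relation.Binary.Core using (Rel)
open import Relation.Binary.Definitions using (Symmetric; tri<; tri≈; tri>)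
open import Relation.Binary.PropositionalEquality hiding ([_])
open import Relation.Nullary using (Dec; yes; no; contradiction; does)
open import Relation.Nullary.Decidable using (map′; T?; dec-true)
open import Relation.Unary using (Pred)

-- Counting below a bound

-- The factor two in the expansion hypothesis is what makes Hall's theorem effective. With t + 1
-- right vertices taken, a set of more than t left vertices still has enough free neighbours, so
-- only sets of at most t elements can violate the condition. One application of E would allow D
-- disjoint children per vertex but leave no such slack; hence the passage to E ∘ E.
--
-- A matching alone does not suffice: no finite part of an ascending walk shows in general whether
-- it will run into a cycle. The stages replace this by a bounded question. After n stages at most n
-- vertices have a cut child, so n + 1 consecutive parents that all have one must contain a
-- repetition. The two spare children in D = d + 2 pay for the cuts: one child falls to the rule
-- about parents without a cut child, and one to the cycle rule, because a vertex has at most one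
-- child on a cycle. Stage n cuts only vertices from n on, so each cut is decided at a known stage,
-- and the walk from n meets a cut within n² steps; this bounds all later searches.

infix 4 _∋_ _∌_

_∋_ _∌_ : (ℕ → Bool) → ℕ → Set
P ∋ x = P x ≡ true
P ∌ x = P x ≡ false

∨-elim : ∀ x {y} → x ∨ y ≡ true → x ≡ true ⊎ y ≡ true
∨-elim true  p = inj₁ refl
∨-elim false p = inj₂ p

∨-introˡ : ∀ {x} y → x ≡ true → x ∨ y ≡ true
∨-introˡ y refl = refl

∨-introʳ : ∀ x {y} → y ≡ true → x ∨ y ≡ true
∨-introʳ true  p = refl
∨-introʳ false p = p

∧-intro : ∀ {x y} → x ≡ true → y ≡ true → x ∧ y ≡ true
∧-intro refl refl = refl

true≢false : {A : Set} {x : Bool} → x ≡ true → x ≡ false → A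
true≢false refl ()

bool-ext : ∀ {x y} → (x ≡ true → y ≡ true) → (y ≡ true → x ≡ true) → x ≡ y
bool-ext {true}  {true}  f g = refl
bool-ext {true}  {false} f g = sym (f refl)
bool-ext {false} {true}  f g = g refl
bool-ext {false} {false} f g = refl

dichotomy : ∀ x → x ≡ true ⊎ x ≡ false
dichotomy true  = inj₁ refl
dichotomy false = inj₂ refl

T⇒true : ∀ {x} → T x → x ≡ true
T⇒true {true} _ = refl

true⇒T : ∀ {x} → x ≡ true → T x
true⇒T refl = _

≤ᵇ-true : ∀ {m n} → m ≤ n → (m ≤ᵇ n) ≡ true
≤ᵇ-true = T⇒true ∘ ≤⇒≤ᵇ

≤ᵇ-true⁻¹ : ∀ m n → (m ≤ᵇ n) ≡ true → m ≤ n
≤ᵇ-true⁻¹ m n = ≤ᵇ⇒≤ m n ∘ true⇒T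

≤ᵇ-false⁻¹ : ∀ {m n} → (m ≤ᵇ n) ≡ false → n < m
≤ᵇ-false⁻¹ p = ≰⇒> λ m≤n → true≢false (≤ᵇ-true m≤n) p

<ᵇ-true : ∀ {m n} → m < n → (m <ᵇ n) ≡ true
<ᵇ-true = T⇒true ∘ <⇒<ᵇ

<ᵇ-true⁻¹ : ∀ m n → (m <ᵇ n) ≡ true → m < n
<ᵇ-true⁻¹ m n = <ᵇ⇒< m n ∘ true⇒T

<ᵇ-false⁻¹ : ∀ {m n} → (m <ᵇ n) ≡ false → n ≤ m
<ᵇ-false⁻¹ p = ≮⇒≥ λ m<n → true≢false (<ᵇ-true m<n) p

≡ᵇ-true : ∀ m n → m ≡ n → (m ≡ᵇ n) ≡ true
≡ᵇ-true m n = T⇒true ∘ ≡⇒≡ᵇ m n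

≡ᵇ-true⁻¹ : ∀ m n → (m ≡ᵇ n) ≡ true → m ≡ n
≡ᵇ-true⁻¹ m n = ≡ᵇ⇒≡ m n ∘ true⇒T

≡ᵇ-false⁻¹ : ∀ m n → (m ≡ᵇ n) ≡ false → m ≢ n
≡ᵇ-false⁻¹ m n p q = true≢false (≡ᵇ-true m n q) p

𝟙 : Bool → ℕ
𝟙 b = if b then 1 else 0

𝟙-mono : ∀ {x y} → (x ≡ true → y ≡ true) → 𝟙 x ≤ 𝟙 y
𝟙-mono {false} f = z≤n
𝟙-mono {true}  f rewrite f refl = ≤-refl

rec : ℕ → (ℕ → ℕ → ℕ) → ℕ → ℕ
rec z s zero    = z
rec z s (suc n) = s n (rec z s n)

sum : (ℕ → ℕ) → ℕ → ℕ
sum f = rec 0 (λ i y → y + f i)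

count : (ℕ → Bool) → ℕ → ℕ
count P = sum (𝟙 ∘ P)

any all : (ℕ → Bool) → ℕ → Bool
any P n = 0 <ᵇ count P n
all P n = not (any (not ∘ P) n)

-- Every i < n such that `P` fails at 0, ..., i contributes one, which adds up to the first
-- solution, or to `n` if there is none.
least : (ℕ → Bool) → ℕ → ℕ
least P = count (λ i → not (any P (suc i)))

sum-mono : ∀ {f g} n → (∀ i → i < n → f i ≤ g i) → sum f n ≤ sum g n
sum-mono zero    h = z≤n
sum-mono (suc n) h = +-mono-≤ (sum-mono n λ i i<n → h i (m<n⇒m<1+n i<n)) (h n ≤-refl)

sum-cong : ∀ {f g} n → (∀ i → i < n → f i ≡ g i) → sum f n ≡ sum g n
sum-cong n h = ≤-antisym (sum-mono n λ i p → ≤-reflexive (h i p))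
                         (sum-mono n λ i p → ≤-reflexive (sym (h i p)))

+-interchange : ∀ a b c e → (a + b) + (c + e) ≡ (a + c) + (b + e)
+-interchange a b c e = begin
  (a + b) + (c + e) ≡⟨ +-assoc a b _ ⟩
  a + (b + (c + e)) ≡⟨ cong (a +_) (sym (+-assoc b c e)) ⟩
  a + ((b + c) + e) ≡⟨ cong (λ z → a + (z + e)) (+-comm b c) ⟩
  a + ((c + b) + e) ≡⟨ cong (a +_) (+-assoc c b e) ⟩
  a + (c + (b + e)) ≡⟨ sym (+-assoc a c _) ⟩
  (a + c) + (b + e) ∎
  where open ≡-Reasoning

sum-+ : ∀ f g n → sum (λ i → f i + g i) n ≡ sum f n + sum g n
sum-+ f g zero    = refl
sum-+ f g (suc n) rewrite sum-+ f g n = +-interchange (sum f n) (sum g n) (f n) (g n)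

sum-* : ∀ k f n → sum (λ i → k * f i) n ≡ k * sum f n
sum-* k f zero    = sym (*-zeroʳ k)
sum-* k f (suc n) rewrite sum-* k f n = sym (*-distribˡ-+ k (sum f n) (f n))

sum-split : ∀ f m n → sum f (m + n) ≡ sum f m + sum (λ i → f (m + i)) n
sum-split f m zero    rewrite +-identityʳ m = sym (+-identityʳ _)
sum-split f m (suc n) rewrite +-suc m n | sum-split f m n = +-assoc (sum f m) _ _

sum-zero : ∀ {f} n → (∀ i → i < n → f i ≡ 0) → sum f n ≡ 0
sum-zero zero    h = refl
sum-zero (suc n) h rewrite sum-zero n (λ i i<n → h i (m<n⇒m<1+n i<n)) = h n ≤-refl

sum-monoʳ : ∀ f {m n} → m ≤ n → sum f m ≤ sum f n
sum-monoʳ f {m} {n} m≤n = subst (λ k → sum f m ≤ sum f k) (m+[n∸m]≡n m≤n)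
  (subst (sum f m ≤_) (sym (sum-split f m (n ∸ m))) (m≤m+n _ _))

sum-stable : ∀ f {m n} → m ≤ n → (∀ i → m ≤ i → f i ≡ 0) → sum f n ≡ sum f m
sum-stable f {m} {n} m≤n h = trans (cong (sum f) (sym (m+[n∸m]≡n m≤n)))
  (trans (sum-split f m (n ∸ m))
  (trans (cong (sum f m +_) (sum-zero (n ∸ m) λ i _ → h (m + i) (m≤m+n m i))) (+-identityʳ _)))

term≤sum : ∀ f {i n} → i < n → f i ≤ sum f n
term≤sum f {i} {n} i<n = ≤-trans (m≤n+m (f i) (sum f i)) (sum-monoʳ f i<n)

count-⊆ : ∀ {P Q} n → (∀ i → i < n → P ∋ i → Q ∋ i) → count P n ≤ count Q n
count-⊆ n h = sum-mono n λ i i<n → 𝟙-mono (h i i<n)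

count-cong : ∀ {P Q} n → (∀ i → i < n → P i ≡ Q i) → count P n ≡ count Q n
count-cong n h = sum-cong n λ i i<n → cong 𝟙 (h i i<n)

count-stable : ∀ P {m n} → m ≤ n → (∀ i → P ∋ i → i < m) → count P n ≡ count P m
count-stable P m≤n h = sum-stable _ m≤n λ i m≤i →
  [ (λ p → contradiction (h i p) (≤⇒≯ m≤i)) , cong 𝟙 ]′ (dichotomy (P i))

count-bounds : ∀ P {m n} → (∀ i → P ∋ i → i < m) → (∀ i → P ∋ i → i < n) → count P m ≡ count P n
count-bounds P {m} {n} hm hn with ≤-total m n
... | inj₁ m≤n = sym (count-stable P m≤n hm)
... | inj₂ n≤m = count-stable P n≤m hn

-- Modularity of counting; the submodularity argument for tight sets rests on it.
count-∪∩ : ∀ P Q n → count (λ i → P i ∨ Q i) n + count (λ i → P i ∧ Q i) n ≡ count P n + count Q n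
count-∪∩ P Q n = begin
  count (λ i → P i ∨ Q i) n + count (λ i → P i ∧ Q i) n ≡⟨ sum-+ _ _ n ⟨
  sum (λ i → 𝟙 (P i ∨ Q i) + 𝟙 (P i ∧ Q i)) n ≡⟨ sum-cong n (λ i _ → pointwise (P i) (Q i)) ⟩
  sum (λ i → 𝟙 (P i) + 𝟙 (Q i)) n ≡⟨ sum-+ _ _ n ⟩
  count P n + count Q n ∎
  where
  open ≡-Reasoning
  pointwise : ∀ x y → 𝟙 (x ∨ y) + 𝟙 (x ∧ y) ≡ 𝟙 x + 𝟙 y
  pointwise true  true  = refl
  pointwise true  false = refl
  pointwise false true  = refl
  pointwise false false = refl

count-∪≤ : ∀ P Q n → count (λ i → P i ∨ Q i) n ≤ count P n + count Q n
count-∪≤ P Q n = ≤-trans (m≤m+n _ _) (≤-reflexive (count-∪∩ P Q n))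

count-disjoint : ∀ P Q n → (∀ i → i < n → P ∋ i → Q ∋ i → ⊥) →
  count (λ i → P i ∨ Q i) n ≡ count P n + count Q n
count-disjoint P Q n h = trans (sym (+-identityʳ _)) (trans (cong (count (λ i → P i ∨ Q i) n +_) (sym z)) (count-∪∩ P Q n))
  where
  z : count (λ i → P i ∧ Q i) n ≡ 0
  z = sum-zero n λ i i<n → [ (λ p → ⊥-elim (h i i<n (∧-conicalˡ _ _ p) (∧-conicalʳ _ _ p))) , cong 𝟙 ]′ (dichotomy (P i ∧ Q i))

count-≤ : ∀ P n → count P n ≤ n
count-≤ P zero = z≤n
count-≤ P (suc n) = ≤-trans (+-mono-≤ (count-≤ P n) (𝟙-mono {P n} {true} (λ _ → refl))) (≤-reflexive (+-comm n 1))

count-single : ∀ v n → count (_≡ᵇ v) n ≤ 1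
count-single v zero = z≤n
count-single v (suc n) with n ≟ v
... | no n≢v rewrite ¬-not (λ p → n≢v (≡ᵇ-true⁻¹ n v p)) | +-identityʳ (count (_≡ᵇ v) n) = count-single v n
... | yes refl rewrite ≡ᵇ-true n n refl = ≤-reflexive (cong (_+ 1) (sum-zero n λ i i<n →
  cong 𝟙 (¬-not (λ p → <⇒≢ i<n (≡ᵇ-true⁻¹ i n p)))))

any-intro : ∀ P {i n} → i < n → P ∋ i → any P n ≡ true
any-intro P i<n p = <ᵇ-true (≤-trans (≤-reflexive (sym (cong 𝟙 p))) (term≤sum (𝟙 ∘ P) i<n))

any-elim : ∀ P n → any P n ≡ true → ∃[ i ] i < n × P ∋ i
any-elim P (suc n) p with dichotomy (P n)
... | inj₁ q = n , ≤-refl , q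
... | inj₂ q rewrite q | +-identityʳ (count P n) with any-elim P n p
...   | i , i<n , r = i , m<n⇒m<1+n i<n , r

any-false : ∀ P {i n} → any P n ≡ false → i < n → P ∌ i
any-false P {i} p i<n = ¬-not λ q → true≢false (any-intro P i<n q) p

any-cong : ∀ {P Q} n → (∀ i → i < n → P i ≡ Q i) → any P n ≡ any Q n
any-cong n h = cong (0 <ᵇ_) (count-cong n h)

all-elim : ∀ P {i n} → all P n ≡ true → i < n → P ∋ i
all-elim P p i<n = not-injective (any-false (not ∘ P) (not-injective p) i<n)

all-false : ∀ P n → all P n ≡ false → ∃[ i ] i < n × P ∌ i
all-false P n p with any-elim (not ∘ P) n (not-injective p)
... | i , i<n , q = i , i<n , not-injective q

least-none : ∀ P n → any P n ≡ false → least P n ≡ n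
least-none P zero p = refl
least-none P (suc n) p
  rewrite least-none P n (¬-not λ q → let (i , i<n , r) = any-elim P n q in true≢false (any-intro P (m<n⇒m<1+n i<n) r) p)
        | p = +-comm n 1

least-∋ : ∀ P n → any P n ≡ true → least P n < n × P ∋ least P n
least-∋ P (suc n) p with dichotomy (any P n)
... | inj₁ q rewrite p | +-identityʳ (least P n) with least-∋ P n q
...   | l , m = m<n⇒m<1+n l , m
least-∋ P (suc n) p | inj₂ q rewrite p | least-none P n q | +-identityʳ n with any-elim P (suc n) p
...   | i , i<1+n , r with m≤n⇒m<n∨m≡n (≤-pred i<1+n)
...     | inj₁ i<n = true≢false (any-intro P i<n r) q
...     | inj₂ refl = ≤-refl , r

least-≤ : ∀ P n → least P n ≤ n
least-≤ P n = count-≤ _ n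

least-minimal : ∀ P n {i} → i < least P n → P ∌ i
least-minimal P (suc n) {i} i<l with dichotomy (any P (suc n))
... | inj₂ q = any-false P q (≤-trans i<l (least-≤ P (suc n)))
... | inj₁ q rewrite q | +-identityʳ (least P n) = least-minimal P n i<l

-- Computability

private variable
  n : ℕ

-- Environments are nested pairs rather than vectors because of the η-rule:
-- a function of an open environment is then a function of its components.
Env : ℕ → Set
Env zero    = ⊤
Env (suc n) = ℕ × Env n

toVec : ∀ n → Env n → Vec ℕ n
toVec zero    _       = []
toVec (suc n) (x , e) = x ∷ toVec n e

get : ∀ {n} → Fin n → Env n → ℕ
get zero    (x , e) = x
get (suc i) (x , e) = get i e

lookup-toVec : ∀ {n} (i : Fin n) e → lookup (toVec n e) i ≡ get i e
lookup-toVec zero    e = refl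
lookup-toVec (suc i) e = lookup-toVec i (proj₂ e)

record Computable (n : ℕ) (f : Env n → ℕ) : Set where
  constructor _by_
  field
    program : Code n
    halts   : ∀ e → program [ toVec n e ]⇓ f e
open Computable

Computableᵇ : (n : ℕ) → (Env n → Bool) → Set
Computableᵇ n P = Computable n (λ e → 𝟙 (P e))

Computable₁ : (ℕ → ℕ) → Set
Computable₁ f = Computable 1 (λ e → f (proj₁ e))

Computable₂ : (ℕ → ℕ → ℕ) → Set
Computable₂ f = Computable 2 (λ e → f (proj₁ e) (proj₁ (proj₂ e)))

Computable₃ : (ℕ → ℕ → ℕ → ℕ) → Set
Computable₃ f = Computable 3 (λ e → f (proj₁ e) (proj₁ (proj₂ e)) (proj₁ (proj₂ (proj₂ e))))

cong-C : {f g : Env n → ℕ} → (∀ e → f e ≡ g e) → Computable n f → Computable n g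
cong-C {n} h (c by r) = c by λ e → subst (c [ toVec n e ]⇓_) (h e) (r e)

var : (i : Fin n) → Computable n (get i)
var {n} i = proj i by λ e → subst (proj i [ toVec n e ]⇓_) (lookup-toVec i e) ⇓proj

app₁ : ∀ {h} → Computable₁ h → ∀ {f} → Computable n f → Computable n (λ e → h (f e))
app₁ (c by r) (c₁ by r₁) = comp c (c₁ ∷ []) by λ e → ⇓comp (r₁ e ∷ []) (r _)

app₂ : ∀ {h} → Computable₂ h → ∀ {f g} → Computable n f → Computable n g →
       Computable n (λ e → h (f e) (g e))
app₂ (c by r) (c₁ by r₁) (c₂ by r₂) =
  comp c (c₁ ∷ c₂ ∷ []) by λ e → ⇓comp (r₁ e ∷ r₂ e ∷ []) (r _)

app₃ : ∀ {k} → Computable₃ k → ∀ {f g h} → Computable n f → Computable n g → Computable n h →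
       Computable n (λ e → k (f e) (g e) (h e))
app₃ (c by r) (c₁ by r₁) (c₂ by r₂) (c₃ by r₃) =
  comp c (c₁ ∷ c₂ ∷ c₃ ∷ []) by λ e → ⇓comp (r₁ e ∷ r₂ e ∷ r₃ e ∷ []) (r _)

suc-C : ∀ {f} → Computable n f → Computable n (λ e → suc (f e))
suc-C (c by r) = comp succ (c ∷ []) by λ e → ⇓comp (r e ∷ []) ⇓succ

zero-C : Computable n (λ _ → 0)
zero-C = comp zero [] by λ e → ⇓comp [] ⇓zero

const-C : ∀ k → Computable n (λ _ → k)
const-C zero    = zero-C
const-C (suc k) = suc-C (const-C k)

projections : ∀ m n → (Fin m → Fin n) → Vec (Code n) m
projections zero    n ρ = []
projections (suc m) n ρ = proj (ρ zero) ∷ projections m n (ρ ∘ suc)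

⇓projections : ∀ m {n} (ρ : Fin m → Fin n) xs e → (∀ i → lookup xs (ρ i) ≡ get i e) →
  Pointwise (λ g y → g [ xs ]⇓ y) (projections m n ρ) (toVec m e)
⇓projections zero    ρ xs e h = []
⇓projections (suc m) ρ xs (x , e) h =
  subst (proj (ρ zero) [ xs ]⇓_) (h zero) ⇓proj ∷ ⇓projections m (ρ ∘ suc) xs e (h ∘ suc)

weaken-C : ∀ {n f} → Computable n f → Computable (suc n) (λ e → f (proj₂ e))
weaken-C {n} (c by r) = comp c (projections n (suc n) suc) by λ e →
  ⇓comp (⇓projections n suc (toVec (suc n) e) (proj₂ e) (λ i → lookup-toVec i (proj₂ e)))
        (r (proj₂ e))

-- In the step of a recursion the accumulator stands between the counter and the parameters; it has
-- to be skipped.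
weaken₁-C : ∀ {n} {f : ℕ → Env n → ℕ} → Computable (suc n) (λ e → f (proj₁ e) (proj₂ e)) →
  Computable (suc (suc n)) (λ e → f (proj₁ e) (proj₂ (proj₂ e)))
weaken₁-C {n} (c by r) = comp c (proj zero ∷ projections n (suc (suc n)) (λ i → suc (suc i))) by λ e →
  ⇓comp (⇓proj ∷ ⇓projections n (λ i → suc (suc i)) (toVec (suc (suc n)) e) (proj₂ (proj₂ e))
                   (λ i → lookup-toVec i (proj₂ (proj₂ e))))
        (r (proj₁ e , proj₂ (proj₂ e)))

rec-C : ∀ {b : Env n → ℕ} {s : ℕ → ℕ → Env n → ℕ} {k} → Computable n b →
  Computable (suc (suc n)) (λ e → s (proj₁ e) (proj₁ (proj₂ e)) (proj₂ (proj₂ e))) →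
  Computable n k → Computable n (λ e → rec (b e) (λ i y → s i y e) (k e))
rec-C {n} {b} {s} {k} (cb by rb) (cs by rs) (ck by rk) =
  comp (primrec cb cs) (ck ∷ projections n n id) by λ e →
    ⇓comp (rk e ∷ ⇓projections n id (toVec n e) e (λ i → lookup-toVec i e)) (run e (k e))
  where
  run : ∀ e m → primrec cb cs [ m ∷ toVec n e ]⇓ rec (b e) (λ i y → s i y e) m
  run e zero    = ⇓primrec-zero (rb e)
  run e (suc m) = ⇓primrec-suc (run e m) (rs (m , rec (b e) (λ i y → s i y e) m , e))

-- `μ` halts at the value 0, so the search runs while `P` holds and stops where it first fails. Only
-- division and `reach` need unbounded search.
minimize-C : ∀ {f : Env n → ℕ} {P : ℕ → Env n → Bool} →
  Computableᵇ (suc n) (λ e → P (proj₁ e) (proj₂ e)) →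
  (∀ e → P (f e) e ≡ false) → (∀ e i → i < f e → P i e ≡ true) →
  Computable n f
minimize-C {n} {f} {P} (c by r) stop go = μ c by λ e → ⇓μ
  (subst (λ b → c [ f e ∷ toVec n e ]⇓ 𝟙 b) (stop e) (r (f e , e)))
  (λ i i<f → 0 , subst (λ b → c [ i ∷ toVec n e ]⇓ 𝟙 b) (go e i i<f) (r (i , e)))

-- A conditional is a primitive recursion of length `𝟙 (b e)`, that is, of zero steps or one.
if-C : ∀ {b : Env n → Bool} {f g} → Computableᵇ n b → Computable n f → Computable n g →
  Computable n (λ e → if b e then f e else g e)
if-C {n} {b} {f} {g} cb cf cg =
  cong-C (λ e → cases (b e) (g e) (f e)) (rec-C {s = λ _ _ → f} cg (weaken-C (weaken-C cf)) cb)
  where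
  cases : ∀ x a b → rec a (λ _ _ → b) (𝟙 x) ≡ (if x then b else a)
  cases true  a b = refl
  cases false a b = refl

v₀ : ∀ {n} → Computable (1 + n) (λ e → proj₁ e)
v₀ = var zero

v₁ : ∀ {n} → Computable (2 + n) (λ e → proj₁ (proj₂ e))
v₁ = var (suc zero)

v₂ : ∀ {n} → Computable (3 + n) (λ e → proj₁ (proj₂ (proj₂ e)))
v₂ = var (suc (suc zero))

v₃ : ∀ {n} → Computable (4 + n) (λ e → proj₁ (proj₂ (proj₂ (proj₂ e))))
v₃ = var (suc (suc (suc zero)))

v₄ : ∀ {n} → Computable (5 + n) (λ e → proj₁ (proj₂ (proj₂ (proj₂ (proj₂ e)))))
v₄ = var (suc (suc (suc (suc zero))))

-- Primitive recursive arithmetic and bounded search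

+-C₂ : Computable₂ _+_
+-C₂ = cong-C (λ e → lemma (proj₁ e) (proj₁ (proj₂ e))) (rec-C v₁ (suc-C v₁) v₀)
  where
  lemma : ∀ m n → rec n (λ _ y → suc y) m ≡ m + n
  lemma zero    n = refl
  lemma (suc m) n = cong suc (lemma m n)

*-C₂ : Computable₂ _*_
*-C₂ = cong-C (λ e → lemma (proj₁ e) (proj₁ (proj₂ e))) (rec-C zero-C (app₂ +-C₂ v₃ v₁) v₀)
  where
  lemma : ∀ m n → rec 0 (λ _ y → n + y) m ≡ m * n
  lemma zero    n = refl
  lemma (suc m) n = cong (n +_) (lemma m n)

pred-C₁ : Computable₁ pred
pred-C₁ = cong-C (λ e → lemma (proj₁ e)) (rec-C zero-C v₀ v₀)
  where
  lemma : ∀ m → rec 0 (λ i _ → i) m ≡ pred m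
  lemma zero    = refl
  lemma (suc m) = refl

∸-C₂ : Computable₂ _∸_
∸-C₂ = cong-C (λ e → lemma (proj₁ e) (proj₁ (proj₂ e))) (rec-C v₀ (app₁ pred-C₁ v₁) v₁)
  where
  lemma : ∀ m n → rec m (λ _ y → pred y) n ≡ m ∸ n
  lemma m zero    = refl
  lemma m (suc n) = trans (cong pred (lemma m n)) (pred[m∸n]≡m∸[1+n] m n)

positive-C₁ : Computable₁ (λ n → 𝟙 (0 <ᵇ n))
positive-C₁ = cong-C (λ e → lemma (proj₁ e)) (rec-C zero-C (const-C 1) v₀)
  where
  lemma : ∀ m → rec 0 (λ _ _ → 1) m ≡ 𝟙 (0 <ᵇ m)
  lemma zero    = refl
  lemma (suc m) = refl

+-C : ∀ {f g} → Computable n f → Computable n g → Computable n (λ e → f e + g e)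
+-C = app₂ +-C₂

*-C : ∀ {f g} → Computable n f → Computable n g → Computable n (λ e → f e * g e)
*-C = app₂ *-C₂

∸-C : ∀ {f g} → Computable n f → Computable n g → Computable n (λ e → f e ∸ g e)
∸-C = app₂ ∸-C₂

not-C : ∀ {P} → Computableᵇ n P → Computableᵇ n (λ e → not (P e))
not-C {n} {P} cP = cong-C (λ e → lemma (P e)) (if-C cP zero-C (const-C 1))
  where
  lemma : ∀ x → (if x then 0 else 1) ≡ 𝟙 (not x)
  lemma true  = refl
  lemma false = refl

∧-C : ∀ {P Q} → Computableᵇ n P → Computableᵇ n Q → Computableᵇ n (λ e → P e ∧ Q e)
∧-C {n} {P} {Q} cP cQ = cong-C (λ e → lemma (P e) (Q e)) (if-C cP cQ zero-C)
  where
  lemma : ∀ x y → (if x then 𝟙 y else 0) ≡ 𝟙 (x ∧ y)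
  lemma true  y = refl
  lemma false y = refl

∨-C : ∀ {P Q} → Computableᵇ n P → Computableᵇ n Q → Computableᵇ n (λ e → P e ∨ Q e)
∨-C {n} {P} {Q} cP cQ = cong-C (λ e → lemma (P e) (Q e)) (if-C cP (const-C 1) cQ)
  where
  lemma : ∀ x y → (if x then 1 else 𝟙 y) ≡ 𝟙 (x ∨ y)
  lemma true  y = refl
  lemma false y = refl

<ᵇ-C : ∀ {f g} → Computable n f → Computable n g → Computableᵇ n (λ e → f e <ᵇ g e)
<ᵇ-C {n} {f} {g} cf cg = cong-C (λ e → cong 𝟙 (lemma (f e) (g e))) (app₁ positive-C₁ (∸-C cg cf))
  where
  lemma : ∀ x y → (0 <ᵇ y ∸ x) ≡ (x <ᵇ y)
  lemma zero    y       = refl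
  lemma (suc x) zero    = refl
  lemma (suc x) (suc y) = lemma x y

≤ᵇ-C : ∀ {f g} → Computable n f → Computable n g → Computableᵇ n (λ e → f e ≤ᵇ g e)
≤ᵇ-C {n} {f} {g} cf cg = cong-C (λ e → cong 𝟙 (lemma (f e) (g e))) (<ᵇ-C cf (suc-C cg))
  where
  lemma : ∀ x y → (x <ᵇ suc y) ≡ (x ≤ᵇ y)
  lemma zero    y = refl
  lemma (suc x) y = refl

≡ᵇ-C : ∀ {f g} → Computable n f → Computable n g → Computableᵇ n (λ e → f e ≡ᵇ g e)
≡ᵇ-C {n} {f} {g} cf cg =
  cong-C (λ e → cong 𝟙 (lemma (f e) (g e))) (∧-C (≤ᵇ-C cf cg) (≤ᵇ-C cg cf))
  where
  lemma : ∀ x y → (x ≤ᵇ y) ∧ (y ≤ᵇ x) ≡ (x ≡ᵇ y)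
  lemma x y = bool-ext
    (λ p → ≡ᵇ-true x y (≤-antisym (≤ᵇ-true⁻¹ x y (∧-conicalˡ _ _ p)) (≤ᵇ-true⁻¹ y x (∧-conicalʳ (x ≤ᵇ y) _ p))))
    (λ p → let q = ≡ᵇ-true⁻¹ x y p in ∧-intro (≤ᵇ-true (≤-reflexive q)) (≤ᵇ-true (≤-reflexive (sym q))))

sum-C : ∀ {f : ℕ → Env n → ℕ} {k} → Computable (suc n) (λ e → f (proj₁ e) (proj₂ e)) →
  Computable n k → Computable n (λ e → sum (λ i → f i e) (k e))
sum-C {n} {f} cf ck = rec-C zero-C (+-C v₁ (weaken₁-C {f = f} cf)) ck

count-C : ∀ {P : ℕ → Env n → Bool} {k} → Computableᵇ (suc n) (λ e → P (proj₁ e) (proj₂ e)) →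
  Computable n k → Computable n (λ e → count (λ i → P i e) (k e))
count-C = sum-C

any-C : ∀ {P : ℕ → Env n → Bool} {k} → Computableᵇ (suc n) (λ e → P (proj₁ e) (proj₂ e)) →
  Computable n k → Computableᵇ n (λ e → any (λ i → P i e) (k e))
any-C {n} {P} cP ck = <ᵇ-C zero-C (count-C {P = P} cP ck)

all-C : ∀ {P : ℕ → Env n → Bool} {k} → Computableᵇ (suc n) (λ e → P (proj₁ e) (proj₂ e)) →
  Computable n k → Computableᵇ n (λ e → all (λ i → P i e) (k e))
all-C {n} {P} cP ck = not-C (any-C {P = λ i e → not (P i e)} (not-C cP) ck)

least-C : ∀ {P : ℕ → Env n → Bool} {k} → Computableᵇ (suc n) (λ e → P (proj₁ e) (proj₂ e)) →
  Computable n k → Computable n (λ e → least (λ i → P i e) (k e))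
least-C {n} {P} cP ck = count-C {P = λ i e → not (any (λ j → P j e) (suc i))} (not-C (any-C {P = λ i e → P i (proj₂ e)} (weaken₁-C {f = λ i e → 𝟙 (P i e)} cP) (suc-C v₀))) ck

-- Iterates, and finite sets coded in binary

iter : (ℕ → ℕ) → ℕ → ℕ → ℕ
iter f n x = rec x (λ _ y → f y) n

iter-comm : ∀ f n x → iter f n (f x) ≡ f (iter f n x)
iter-comm f zero    x = refl
iter-comm f (suc n) x = cong f (iter-comm f n x)

iter-+ : ∀ f m n x → iter f (m + n) x ≡ iter f m (iter f n x)
iter-+ f zero    n x = refl
iter-+ f (suc m) n x = cong f (iter-+ f m n x)

iter-C : ∀ {f : ℕ → ℕ} → Computable₁ f → ∀ {k g : Env n → ℕ} → Computable n k → Computable n g → Computable n (λ e → iter f (k e) (g e))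
iter-C cf ck cg = rec-C cg (app₁ cf v₁) ck

odd : ℕ → Bool
odd zero    = false
odd (suc n) = not (odd n)

half : ℕ → ℕ
half zero    = 0
half (suc n) = half n + 𝟙 (odd n)

-- The number `a` codes the finite set of all `i` with `bit i a`, so that programs can take sets as
-- arguments.
bit : ℕ → ℕ → Bool
bit zero    a = odd a
bit (suc i) a = bit i (half a)

2^ : ℕ → ℕ
2^ = rec 1 (λ _ y → y + y)

odd-C₁ : Computable₁ (λ n → 𝟙 (odd n))
odd-C₁ = cong-C (λ e → lemma (proj₁ e)) (rec-C zero-C (∸-C (const-C 1) v₁) v₀)
  where
  flip : ∀ x → 1 ∸ 𝟙 x ≡ 𝟙 (not x)
  flip true  = refl
  flip false = refl
  lemma : ∀ m → rec 0 (λ _ y → 1 ∸ y) m ≡ 𝟙 (odd m)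
  lemma zero    = refl
  lemma (suc m) = trans (cong (1 ∸_) (lemma m)) (flip (odd m))

half-C₁ : Computable₁ half
half-C₁ = cong-C (λ e → lemma (proj₁ e)) (rec-C zero-C (+-C v₁ (app₁ odd-C₁ v₀)) v₀)
  where
  lemma : ∀ m → rec 0 (λ i y → y + 𝟙 (odd i)) m ≡ half m
  lemma zero    = refl
  lemma (suc m) = cong (_+ 𝟙 (odd m)) (lemma m)

bit-C₂ : Computable₂ (λ i a → 𝟙 (bit i a))
bit-C₂ = cong-C (λ e → cong 𝟙 (lemma (proj₁ e) (proj₁ (proj₂ e)))) (app₁ odd-C₁ (iter-C half-C₁ v₀ v₁))
  where
  lemma : ∀ i a → odd (iter half i a) ≡ bit i a
  lemma zero    a = refl
  lemma (suc i) a = trans (cong odd (sym (iter-comm half i a))) (lemma i (half a))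

bit-C : ∀ {n f g} → Computable n f → Computable n g → Computableᵇ n (λ e → bit (f e) (g e))
bit-C = app₂ bit-C₂

2^-C₁ : Computable₁ 2^
2^-C₁ = rec-C (const-C 1) (+-C v₁ v₁) v₀

odd-double+ : ∀ m a → odd (m + m + a) ≡ odd a
odd-double+ zero    a = refl
odd-double+ (suc m) a rewrite +-suc m m | odd-double+ m a = not-involutive (odd a)

half-double+ : ∀ m a → half (m + m + a) ≡ m + half a
half-double+ zero    a = refl
half-double+ (suc m) a rewrite +-suc m m | half-double+ m a | odd-double+ m a with odd a
... | true  = trans (+-identityʳ _) (+-comm (m + half a) 1)
... | false = trans (cong (_+ 1) (+-identityʳ (m + half a))) (+-comm (m + half a) 1)

-- No carry occurs, because the bit at `v` is zero.
bit-insert : ∀ v a → bit v a ≡ false → ∀ i → bit i (2^ v + a) ≡ bit i a ∨ (i ≡ᵇ v)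
bit-insert zero a p zero    rewrite p = refl
bit-insert zero a p (suc i) rewrite p | +-identityʳ (half a) = sym (∨-identityʳ _)
bit-insert (suc v) a p zero    = trans (odd-double+ (2^ v) a) (sym (∨-identityʳ _))
bit-insert (suc v) a p (suc i) rewrite half-double+ (2^ v) a = bit-insert v (half a) p i

insert : ℕ → ℕ → ℕ
insert v a = if bit v a then a else 2^ v + a

insert-C : ∀ {n f g} → Computable n f → Computable n g → Computable n (λ e → insert (f e) (g e))
insert-C cf cg = if-C (bit-C cf cg) cg (+-C (app₁ 2^-C₁ cf) cg)

bit-insert-≡ : ∀ v a i → bit i (insert v a) ≡ bit i a ∨ (i ≡ᵇ v)
bit-insert-≡ v a i with dichotomy (bit v a)
... | inj₂ p rewrite p = bit-insert v a p i
... | inj₁ p rewrite p = bool-ext (λ q → ∨-introˡ (i ≡ᵇ v) q)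
  (λ q → [ id , (λ r → subst (λ z → bit z a ≡ true) (sym (≡ᵇ-true⁻¹ i v r)) p) ]′ (∨-elim (bit i a) q))

bit-zero : ∀ i → bit i 0 ≡ false
bit-zero zero    = refl
bit-zero (suc i) = bit-zero i

-- The code of the part of `P` below `n`. As it is less than `2^ n`, quantifying over subsets
-- becomes a bounded quantifier.
mask : (ℕ → Bool) → ℕ → ℕ
mask P zero    = 0
mask P (suc n) = mask (P ∘ suc) n + mask (P ∘ suc) n + 𝟙 (P 0)

half𝟙 : ∀ x → half (𝟙 x) ≡ 0
half𝟙 true  = refl
half𝟙 false = refl

bit-mask : ∀ P n i → i < n → bit i (mask P n) ≡ P i
bit-mask P (suc n) zero    _   rewrite odd-double+ (mask (P ∘ suc) n) (𝟙 (P 0)) with P 0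
... | true  = refl
... | false = refl
bit-mask P (suc n) (suc i) i<n rewrite half-double+ (mask (P ∘ suc) n) (𝟙 (P 0)) | half𝟙 (P 0)
  | +-identityʳ (mask (P ∘ suc) n) = bit-mask (P ∘ suc) n i (≤-pred i<n)

mask<2^ : ∀ P n → mask P n < 2^ n
mask<2^ P zero    = ≤-refl
mask<2^ P (suc n) = let h = mask<2^ (P ∘ suc) n in begin-strict
  m + m + 𝟙 (P 0) ≤⟨ +-monoʳ-≤ (m + m) (𝟙-mono {P 0} {true} λ _ → refl) ⟩
  m + m + 1       ≡⟨ +-comm (m + m) 1 ⟩
  suc m + m       <⟨ +-monoʳ-< (suc m) h ⟩
  suc m + 2^ n    ≤⟨ +-monoˡ-≤ (2^ n) h ⟩
  2^ n + 2^ n     ∎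
  where
  open ≤-Reasoning
  m = mask (P ∘ suc) n

-- Hall's theorem, effectively

not-true : ∀ {x} → x ≡ false → not x ≡ true
not-true refl = refl

-- An element of `Q` outside `P` would make the count of `Q` strictly larger.
count-≡⇒⊇ : ∀ {P Q} n → (∀ i → P ∋ i → Q ∋ i) → count Q n ≤ count P n →
  ∀ i → i < n → Q ∋ i → P ∋ i
count-≡⇒⊇ {P} {Q} n P⊆Q le i i<n q with dichotomy (P i)
... | inj₁ p = p
... | inj₂ p = contradiction le (<⇒≱ (lt n i<n))
  where
  lt : ∀ n → i < n → count P n < count Q n
  lt (suc n) i<1+n with m≤n⇒m<n∨m≡n (≤-pred i<1+n)
  ... | inj₁ i<n = +-mono-<-≤ (lt n i<n) (𝟙-mono (P⊆Q n))
  ... | inj₂ refl rewrite p | q = +-mono-≤-< (count-⊆ n λ j _ → P⊆Q j) (s≤s z≤n)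

-- Each step that does not stall gains at least one. This finds a radius at which a small set stops
-- growing.
stationary : ∀ (c : ℕ → ℕ) → (∀ j → c j ≤ c (suc j)) →
  ∀ k → (∃[ j ] j < k × c (suc j) ≤ c j) ⊎ k ≤ c k
stationary c mono zero = inj₂ z≤n
stationary c mono (suc k) with stationary c mono k
... | inj₁ (j , j<k , p) = inj₁ (j , m<n⇒m<1+n j<k , p)
... | inj₂ k≤ck with c (suc k) ≤? c k
...   | yes p = inj₁ (k , ≤-refl , p)
...   | no ¬p = inj₂ (≤-<-trans k≤ck (≰⇒> ¬p))

_∪⁺_ : (ℕ → Bool) → ℕ → ℕ → Bool
(S ∪⁺ v) w = S w ∨ (w ≡ᵇ v)

module Hall
  (adj : ℕ → ℕ → Bool) (bR bL : ℕ → ℕ)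
  (bR-mono : ∀ {m n} → m ≤ n → bR m ≤ bR n)
  (adj-R : ∀ {a w m} → adj a w ≡ true → a < m → w < bR m)
  (adj-L : ∀ {a w m} → adj a w ≡ true → w < m → a < bL m)
  (inflating : ∀ m → m ≤ bL (bR m))
  where

  N : (ℕ → Bool) → ℕ → Bool
  N A w = any (λ a → A a ∧ adj a w) (bL (suc w))

  N-intro : ∀ A {a w} → A ∋ a → adj a w ≡ true → N A ∋ w
  N-intro A {a} {w} p q = any-intro (λ a → A a ∧ adj a w) (adj-L q ≤-refl) (∧-intro p q)

  N-elim : ∀ A {w} → N A ∋ w → ∃[ a ] A ∋ a × adj a w ≡ true
  N-elim A {w} p with any-elim (λ a → A a ∧ adj a w) (bL (suc w)) p
  ... | a , _ , q = a , ∧-conicalˡ _ _ q , ∧-conicalʳ (A a) _ q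

  N-mono : ∀ {A A′} → (∀ a → A ∋ a → A′ ∋ a) → ∀ {w} → N A ∋ w → N A′ ∋ w
  N-mono {A} {A′} h p with N-elim A p
  ... | a , q , r = N-intro A′ (h a q) r

  free : (ℕ → Bool) → (ℕ → Bool) → ℕ → Bool
  free S A w = N A w ∧ not (S w)

  free-intro : ∀ S A {w} → N A ∋ w → S ∌ w → free S A ∋ w
  free-intro S A p q = ∧-intro p (not-true q)

  free-N : ∀ S A {w} → free S A ∋ w → N A ∋ w
  free-N S A = ∧-conicalˡ _ _

  free-∌ : ∀ S A {w} → free S A ∋ w → S ∌ w
  free-∌ S A {w} p = not-injective (∧-conicalʳ (N A w) _ p)

  free-bound : ∀ S A {M} → (∀ a → A ∋ a → a < M) → ∀ w → free S A ∋ w → w < bR M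
  free-bound S A h w p with N-elim A (free-N S A p)
  ... | a , q , r = adj-R r (h a q)

  free-cong : ∀ {S S′ A A′} → (∀ w → S w ≡ S′ w) → (∀ a → A a ≡ A′ a) → ∀ w → free S A w ≡ free S′ A′ w
  free-cong h h′ w = cong₂ (λ x y → x ∧ not y) (any-cong (bL (suc w)) λ a _ → cong (_∧ adj a w) (h′ a)) (h w)

  ∪⁺-∌ : ∀ S {v w} → S ∌ w → w ≢ v → (S ∪⁺ v) ∌ w
  ∪⁺-∌ S {v} {w} p q rewrite p = ¬-not λ r → q (≡ᵇ-true⁻¹ w v r)

  -- Hall's condition for the left vertices ≥ t, the right vertices in S being taken.
  Condition : ℕ → (ℕ → Bool) → Set
  Condition t S = ∀ A M → (∀ a → A ∋ a → t ≤ a × a < M) → count A M ≤ count (free S A) (bR M)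

  Condition-cong : ∀ {t S S′} → (∀ w → S w ≡ S′ w) → Condition t S → Condition t S′
  Condition-cong h c A M sup =
    subst (count A M ≤_) (count-cong (bR M) λ w _ → free-cong {A = A} h (λ _ → refl) w) (c A M sup)

  -- `bL (bR m)` bounds the left vertices that share a neighbour with one below `m`. It is applied
  -- at least once, so that `region t 0` already exceeds all left vertices sharing a neighbour with
  -- `t`.
  region : ℕ → ℕ → ℕ
  region t j = iter (λ m → bL (bR m)) (suc j) (suc t)

  -- A set of at most `t` elements cannot grow at each of the `t + 1` steps from `region t 0` up to
  -- here.
  horizon : ℕ → ℕ
  horizon t = region t (suc t)

  region-mono : ∀ t {i j} → i ≤ j → region t i ≤ region t j
  region-mono t {i} {j} i≤j = subst (λ k → region t i ≤ region t k) (m∸n+n≡m i≤j) (go (j ∸ i))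
    where
    go : ∀ k → region t i ≤ region t (k + i)
    go zero    = ≤-refl
    go (suc k) = ≤-trans (go k) (inflating _)

  <-horizon : ∀ t → t < horizon t
  <-horizon t = ≤-trans (inflating (suc t)) (region-mono t {0} {suc t} z≤n)

  Local : ℕ → (ℕ → Bool) → Set
  Local t S = ∀ A → (∀ a → A ∋ a → t < a × a < horizon t) →
    count A (horizon t) ≤ count (free S A) (bR (horizon t))

  -- Each code is trimmed to the window between `t` and the horizon, so the codes below
  -- `2^ (horizon t)` yield exactly the sets that `Local` speaks of.
  localᵇ : ℕ → (ℕ → Bool) → Bool
  localᵇ t S = all (λ c → count (λ a → bit a c ∧ ((t <ᵇ a) ∧ (a <ᵇ horizon t))) (horizon t)
                          ≤ᵇ count (free S (λ a → bit a c ∧ ((t <ᵇ a) ∧ (a <ᵇ horizon t)))) (bR (horizon t)))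
                   (2^ (horizon t))

  localᵇ-sound : ∀ t S → localᵇ t S ≡ true → Local t S
  localᵇ-sound t S p A sup = subst₂ _≤_
    (count-cong (horizon t) λ a _ → same a)
    (count-cong (bR (horizon t)) λ w _ → free-cong {S} (λ _ → refl) same w)
    (≤ᵇ-true⁻¹ _ _ (all-elim _ p (mask<2^ A (horizon t))))
    where
    same : ∀ a → bit a (mask A (horizon t)) ∧ ((t <ᵇ a) ∧ (a <ᵇ horizon t)) ≡ A a
    same a = bool-ext
      (λ q → let r = ∧-conicalʳ (bit a (mask A (horizon t))) _ q in
        trans (sym (bit-mask A (horizon t) a (<ᵇ-true⁻¹ a _ (∧-conicalʳ (t <ᵇ a) _ r)))) (∧-conicalˡ _ _ q))
      (λ q → let (t<a , a<h) = sup a q in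
        ∧-intro (trans (bit-mask A (horizon t) a a<h) q) (∧-intro (<ᵇ-true t<a) (<ᵇ-true a<h)))

  localᵇ-complete : ∀ t S → localᵇ t S ≡ false →
    ∃[ A ] (∀ a → A ∋ a → t < a × a < horizon t) × count (free S A) (bR (horizon t)) < count A (horizon t)
  localᵇ-complete t S p with all-false _ (2^ (horizon t)) p
  ... | c , _ , q = _ , (λ a r → let s = ∧-conicalʳ (bit a c) _ r in
          <ᵇ-true⁻¹ t a (∧-conicalˡ _ _ s) , <ᵇ-true⁻¹ a _ (∧-conicalʳ (t <ᵇ a) _ s)) , ≤ᵇ-false⁻¹ q

  module _
    (expansion : ∀ A M → (∀ a → A ∋ a → a < M) → 2 * count A M ≤ count (N A) (bR M))
    where

    -- A set of more than t vertices satisfies the condition by expansion.  In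
    -- a smaller set A the intersections with the regions stop growing at some
    -- point; there A splits into a part below the horizon and a part without
    -- common neighbours with it.
    extend : ∀ {t S v} → Condition t S → (∀ W → count S W ≤ t) → adj t v ≡ true →
      Local t (S ∪⁺ v) → Condition (suc t) (S ∪⁺ v)
    extend {t} {S} {v} hall small adj-tv loc A M sup with stationary c c-mono (suc t)
      where
      part : ℕ → ℕ → Bool
      part j a = A a ∧ (a <ᵇ region t j)
      c : ℕ → ℕ
      c j = count (part j) M
      c-mono : ∀ j → c j ≤ c (suc j)
      c-mono j = count-⊆ M λ a _ p → ∧-intro (∧-conicalˡ _ _ p)
        (<ᵇ-true (≤-trans (<ᵇ-true⁻¹ a _ (∧-conicalʳ (A a) _ p)) (inflating (region t j))))
    -- Here `A` has more than `t` elements, so the second copy of |A| granted by expansion pays for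
    -- the at most `t + 1` taken vertices.
    ... | inj₂ big = +-cancelʳ-≤ (suc t) _ _ (begin
      count A M + suc t ≤⟨ +-monoʳ-≤ (count A M) (≤-trans big (count-⊆ M λ a _ → ∧-conicalˡ _ _)) ⟩
      count A M + count A M ≡⟨ cong (count A M +_) (sym (+-identityʳ (count A M))) ⟩
      2 * count A M ≤⟨ expansion A M (λ a p → proj₂ (sup a p)) ⟩
      count (N A) (bR M) ≤⟨ count-⊆ (bR M) (λ w _ p → cover w p) ⟩
      count (λ w → free (S ∪⁺ v) A w ∨ (S ∪⁺ v) w) (bR M) ≤⟨ count-∪≤ _ (S ∪⁺ v) (bR M) ⟩
      count (free (S ∪⁺ v) A) (bR M) + count (S ∪⁺ v) (bR M) ≤⟨ +-monoʳ-≤ _ (≤-trans (count-∪≤ S (_≡ᵇ v) (bR M))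
        (≤-trans (+-mono-≤ (small (bR M)) (count-single v (bR M))) (≤-reflexive (+-comm t 1)))) ⟩
      count (free (S ∪⁺ v) A) (bR M) + suc t ∎)
      where
      open ≤-Reasoning
      cover : ∀ w → N A ∋ w → free (S ∪⁺ v) A w ∨ (S ∪⁺ v) w ≡ true
      cover w p with dichotomy ((S ∪⁺ v) w)
      ... | inj₁ q = ∨-introʳ (free (S ∪⁺ v) A w) q
      ... | inj₂ q = ∨-introˡ ((S ∪⁺ v) w) (free-intro (S ∪⁺ v) A p q)
    -- The near part is covered by the local test. The far part is not adjacent to `v`, so the old
    -- condition, with `v` not yet taken, suffices for it.
    ... | inj₁ (j , j<1+t , stops) = begin
      count A M ≤⟨ count-⊆ M (λ a _ p → split a p) ⟩
      count (λ a → near a ∨ far a) M ≤⟨ count-∪≤ near far M ⟩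
      count near M + count far M ≤⟨ +-mono-≤ near-ok (hall far M λ a p →
        let (t<a , a<M) = sup a (∧-conicalˡ _ _ p) in <⇒≤ t<a , a<M) ⟩
      count (free (S ∪⁺ v) near) (bR M) + count (free S far) (bR M)
        ≡⟨ sym (count-disjoint (free (S ∪⁺ v) near) (free S far) (bR M) disjoint) ⟩
      count (λ w → free (S ∪⁺ v) near w ∨ free S far w) (bR M) ≤⟨ count-⊆ (bR M) (λ w _ p →
        [ near⊆ w , far⊆ w ]′ (∨-elim (free (S ∪⁺ v) near w) p)) ⟩
      count (free (S ∪⁺ v) A) (bR M) ∎
      where
      open ≤-Reasoning
      near far : ℕ → Bool
      near a = A a ∧ (a <ᵇ region t j)
      far  a = A a ∧ not (a <ᵇ region t j)
      near⊆A : ∀ a → near ∋ a → A ∋ a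
      near⊆A a = ∧-conicalˡ _ _
      far⊆A : ∀ a → far ∋ a → A ∋ a
      far⊆A a = ∧-conicalˡ _ _
      near-< : ∀ a → near ∋ a → a < region t j
      near-< a p = <ᵇ-true⁻¹ a _ (∧-conicalʳ (A a) _ p)
      far-≥ : ∀ a → far ∋ a → region t j ≤ a
      far-≥ a p = <ᵇ-false⁻¹ (not-injective (∧-conicalʳ (A a) _ p))
      split : ∀ a → A ∋ a → near a ∨ far a ≡ true
      split a p with dichotomy (a <ᵇ region t j)
      ... | inj₁ q = ∨-introˡ (far a) (∧-intro p q)
      ... | inj₂ q = ∨-introʳ (near a) (∧-intro p (not-true q))
      near-<M : ∀ a → near ∋ a → a < M
      near-<M a p = proj₂ (sup a (near⊆A a p))
      near-<h : ∀ a → near ∋ a → a < horizon t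
      near-<h a p = ≤-trans (near-< a p) (region-mono t {j} {suc t} (<⇒≤ j<1+t))
      near-ok : count near M ≤ count (free (S ∪⁺ v) near) (bR M)
      near-ok = subst₂ _≤_
        (count-bounds near near-<h near-<M)
        (count-bounds (free (S ∪⁺ v) near) (free-bound (S ∪⁺ v) near near-<h) (free-bound (S ∪⁺ v) near near-<M))
        (loc near λ a p → proj₁ (sup a (near⊆A a p)) , near-<h a p)
      -- A common neighbour would put `a′` into the next region, where `A` gains nothing, so `a′`
      -- would already be near.
      disjoint : ∀ w → w < bR M → free (S ∪⁺ v) near ∋ w → free S far ∋ w → ⊥
      disjoint w _ p q with N-elim near (free-N (S ∪⁺ v) near p) | N-elim far (free-N S far q)
      ... | a , na , aw | a′ , fa′ , a′w = <⇒≱ (near-< a′ (count-≡⇒⊇ M grows stops a′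
              (proj₂ (sup a′ (far⊆A a′ fa′))) (∧-intro (far⊆A a′ fa′) (<ᵇ-true (adj-L a′w (adj-R aw (near-< a na)))))))
              (far-≥ a′ fa′)
        where
        grows : ∀ a → near ∋ a → A a ∧ (a <ᵇ region t (suc j)) ≡ true
        grows a p = ∧-intro (near⊆A a p) (<ᵇ-true (≤-trans (near-< a p) (inflating _)))
      near⊆ : ∀ w → free (S ∪⁺ v) near ∋ w → free (S ∪⁺ v) A ∋ w
      near⊆ w p = free-intro (S ∪⁺ v) A (N-mono near⊆A (free-N (S ∪⁺ v) near p)) (free-∌ (S ∪⁺ v) near p)
      far⊆ : ∀ w → free S far ∋ w → free (S ∪⁺ v) A ∋ w
      far⊆ w p = free-intro (S ∪⁺ v) A (N-mono far⊆A (free-N S far p)) (∪⁺-∌ S (free-∌ S far p) w≢v)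
        where
        w≢v : w ≢ v
        w≢v refl with N-elim far (free-N S far p)
        -- All left neighbours of `v`, itself a neighbour of `t`, lie below `region t 0`.
        ... | a , fa , av = <⇒≱ (≤-trans (adj-L av (adj-R adj-tv ≤-refl)) (region-mono t {0} {j} z≤n)) (far-≥ a fa)

  -- One step of the matching

  module Step {t : ℕ} {S : ℕ → Bool} (hall : Condition t S) where

    private
      h W : ℕ
      h = horizon t
      W = bR (horizon t)

      -- Under Hall's condition equality holds: these sets have no free neighbour to spare.
      Tight : (ℕ → Bool) → Set
      Tight A = (∀ a → A ∋ a → t < a × a < h) × count (free S A) W ≤ count A h

      weaken : ∀ {A} → (∀ a → A ∋ a → t < a × a < h) → ∀ a → A ∋ a → t ≤ a × a < h
      weaken sup a p = let (t<a , a<h) = sup a p in <⇒≤ t<a , a<h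

      -- Submodularity: the neighbours of the intersection lie in both neighbourhoods, and Hall's
      -- condition for the intersection makes its terms cancel.
      tight-∪ : ∀ {A A′} → Tight A → Tight A′ → Tight (λ a → A a ∨ A′ a)
      tight-∪ {A} {A′} (sup , le) (sup′ , le′) = (λ a p → [ sup a , sup′ a ]′ (∨-elim (A a) p)) ,
        +-cancelʳ-≤ (count A∩A′ h) _ _ (begin
          count (free S A∪A′) W + count A∩A′ h ≤⟨ +-mono-≤
            (count-⊆ W λ w _ p → union w p)
            (≤-trans (hall A∩A′ h λ a p → weaken sup a (∧-conicalˡ _ _ p)) (count-⊆ W λ w _ p → inter w p)) ⟩
          count (λ w → free S A w ∨ free S A′ w) W + count (λ w → free S A w ∧ free S A′ w) W
            ≡⟨ count-∪∩ (free S A) (free S A′) W ⟩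
          count (free S A) W + count (free S A′) W ≤⟨ +-mono-≤ le le′ ⟩
          count A h + count A′ h ≡⟨ sym (count-∪∩ A A′ h) ⟩
          count A∪A′ h + count A∩A′ h ∎)
        where
        open ≤-Reasoning
        A∪A′ A∩A′ : ℕ → Bool
        A∪A′ a = A a ∨ A′ a
        A∩A′ a = A a ∧ A′ a
        union : ∀ w → free S A∪A′ ∋ w → free S A w ∨ free S A′ w ≡ true
        union w p with N-elim A∪A′ (free-N S A∪A′ p)
        ... | a , q , r with ∨-elim (A a) q
        ...   | inj₁ s = ∨-introˡ (free S A′ w) (free-intro S A (N-intro A s r) (free-∌ S A∪A′ p))
        ...   | inj₂ s = ∨-introʳ (free S A w) (free-intro S A′ (N-intro A′ s r) (free-∌ S A∪A′ p))
        inter : ∀ w → free S A∩A′ ∋ w → free S A w ∧ free S A′ w ≡ true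
        inter w p = ∧-intro
          (free-intro S A (N-mono (λ a → ∧-conicalˡ _ _) (free-N S A∩A′ p)) (free-∌ S A∩A′ p))
          (free-intro S A′ (N-mono (λ a → ∧-conicalʳ (A a) _) (free-N S A∩A′ p)) (free-∌ S A∩A′ p))

      -- Taking `v` costs at most one free neighbour, so a set that fails afterwards had none to
      -- spare before. Were `v` not among its neighbours, nothing would have changed.
      violated⇒tight : ∀ v A → (∀ a → A ∋ a → t < a × a < h) → count (free (S ∪⁺ v) A) W < count A h →
        Tight A × N A ∋ v
      violated⇒tight v A sup lt = (sup , (begin
          count (free S A) W ≤⟨ count-⊆ W (λ w _ p → cover w p) ⟩
          count (λ w → free (S ∪⁺ v) A w ∨ (w ≡ᵇ v)) W ≤⟨ count-∪≤ _ (_≡ᵇ v) W ⟩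
          count (free (S ∪⁺ v) A) W + count (_≡ᵇ v) W ≤⟨ +-monoʳ-≤ _ (count-single v W) ⟩
          count (free (S ∪⁺ v) A) W + 1 ≡⟨ +-comm _ 1 ⟩
          suc (count (free (S ∪⁺ v) A) W) ≤⟨ lt ⟩
          count A h ∎)) , v∈N
        where
        open ≤-Reasoning
        cover : ∀ w → free S A ∋ w → free (S ∪⁺ v) A w ∨ (w ≡ᵇ v) ≡ true
        cover w p with dichotomy (w ≡ᵇ v)
        ... | inj₁ q = ∨-introʳ (free (S ∪⁺ v) A w) q
        ... | inj₂ q = ∨-introˡ (w ≡ᵇ v) (free-intro (S ∪⁺ v) A (free-N S A p)
                         (∪⁺-∌ S (free-∌ S A p) (≡ᵇ-false⁻¹ w v q)))
        v∈N : N A ∋ v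
        v∈N with dichotomy (N A v)
        ... | inj₁ p = p
        ... | inj₂ p = contradiction (≤-trans (hall A h (weaken sup)) (count-⊆ W λ w _ q →
                free-intro (S ∪⁺ v) A (free-N S A q) (∪⁺-∌ S (free-∌ S A q) λ { refl → true≢false (free-N S A q) p })))
              (<⇒≱ lt)

      -- Each rejected neighbour contributes a violating set, and tightness survives unions; the
      -- empty set is the start.
      tight-cover : ∀ k → (∀ v → v < k → adj t v ≡ true → S ∌ v → localᵇ t (S ∪⁺ v) ≡ false) →
        ∃[ U ] Tight U × (∀ v → v < k → adj t v ≡ true → S ∌ v → N U ∋ v)
      tight-cover zero    bad = (λ _ → false) , ((λ _ ()) , ≤-reflexive (trans (sum-zero W λ w _ → cong 𝟙 (isolated w)) (sym (sum-zero h λ _ _ → refl)))) , λ _ ()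
        where
        isolated : ∀ w → free S (λ _ → false) ∌ w
        isolated w = ¬-not λ p → case-⊥ (N-elim (λ _ → false) (free-N S (λ _ → false) {w} p))
          where
          case-⊥ : (∃[ a ] false ≡ true × adj a w ≡ true) → ⊥
          case-⊥ ()
      tight-cover (suc k) bad with tight-cover k (λ v v<k → bad v (m<n⇒m<1+n v<k))
      ... | U , tight , cov with dichotomy (adj t k ∧ not (S k))
      ...   | inj₂ q = U , tight , λ v v<1+k r s → [ (λ v<k → cov v v<k r s)
                , (λ { refl → true≢false (∧-intro r (not-true s)) q }) ]′ (m≤n⇒m<n∨m≡n (≤-pred v<1+k))
      ...   | inj₁ q with localᵇ-complete t (S ∪⁺ k) (bad k ≤-refl (∧-conicalˡ _ _ q) (not-injective (∧-conicalʳ (adj t k) _ q)))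
      ...     | A , sup , lt with violated⇒tight k A sup lt
      ...       | tightA , k∈NA = (λ a → U a ∨ A a) , tight-∪ tight tightA , λ v v<1+k r s →
                  [ (λ v<k → N-mono (λ a → ∨-introˡ (A a)) (cov v v<k r s))
                  , (λ { refl → N-mono (λ a → ∨-introʳ (U a)) k∈NA }) ]′ (m≤n⇒m<n∨m≡n (≤-pred v<1+k))

    candidate : ℕ → Bool
    candidate v = adj t v ∧ (not (S v) ∧ localᵇ t (S ∪⁺ v))

    -- If every neighbour were blocked by a tight set, then so would be all of
    -- them by a single tight set U, and U ∪ {t} would violate the condition.
    candidate-exists : any candidate (bR (suc t)) ≡ true
    candidate-exists with dichotomy (any candidate (bR (suc t)))
    ... | inj₁ p = p
    ... | inj₂ p with tight-cover (bR (suc t)) (λ v v<k q r → ¬-not λ s →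
                        true≢false (∧-intro q (∧-intro (not-true r) s)) (any-false candidate p v<k))
    ...   | U , (sup , le) , cov = contradiction (begin
              suc (count U h) ≡⟨ +-comm 1 (count U h) ⟩
              count U h + 1 ≤⟨ +-monoʳ-≤ (count U h) (≤-trans (≤-reflexive (sym (cong 𝟙 (≡ᵇ-true t t refl)))) (term≤sum (λ a → 𝟙 (a ≡ᵇ t)) (<-horizon t))) ⟩
              count U h + count (_≡ᵇ t) h ≡⟨ sym (count-disjoint U (_≡ᵇ t) h λ a _ q r →
                <-irrefl (sym (≡ᵇ-true⁻¹ a t r)) (proj₁ (sup a q))) ⟩
              count (U ∪⁺ t) h ≤⟨ hall (U ∪⁺ t) h (λ a q → [ weaken sup a
                , (λ r → ≤-reflexive (sym (≡ᵇ-true⁻¹ a t r)) , subst (_< h) (sym (≡ᵇ-true⁻¹ a t r)) (<-horizon t)) ]′ (∨-elim (U a) q)) ⟩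
              count (free S (U ∪⁺ t)) W ≤⟨ count-⊆ W (λ w _ q → free-intro S U (N-U w q) (free-∌ S (U ∪⁺ t) q)) ⟩
              count (free S U) W ≤⟨ le ⟩
              count U h ∎) 1+n≰n
      where
      open ≤-Reasoning
      N-U : ∀ w → free S (U ∪⁺ t) ∋ w → N U ∋ w
      N-U w q with N-elim (U ∪⁺ t) (free-N S (U ∪⁺ t) q)
      ... | a , r , aw with ∨-elim (U a) r
      ...   | inj₁ s = N-intro U s aw
      ...   | inj₂ s with ≡ᵇ-true⁻¹ a t s
      ...     | refl = cov w (adj-R aw ≤-refl) aw (free-∌ S (U ∪⁺ t) q)

  candidateᵇ : ℕ → ℕ → ℕ → Bool
  candidateᵇ t s v = adj t v ∧ (not (bit v s) ∧ localᵇ t ((λ w → bit w s) ∪⁺ v))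

  pick : ℕ → ℕ → ℕ
  pick t s = least (candidateᵇ t s) (bR (suc t))

  -- The accumulator codes the right vertices taken by `0, …, t - 1`, which turns the dependence on
  -- all earlier choices into primitive recursion.
  used : ℕ → ℕ
  used = rec 0 (λ t s → insert (pick t s) s)

  match : ℕ → ℕ
  match t = pick t (used t)

  module Matching
    (expansion : ∀ A M → (∀ a → A ∋ a → a < M) → 2 * count A M ≤ count (N A) (bR M))
    where

    -- Simultaneous recursion with `match-candidate`: the condition at `t` yields a candidate, and
    -- accepting it carries the condition to `t + 1`. The size bound is what `extend` weighs against
    -- expansion.
    invariant : ∀ t → Condition t (λ w → bit w (used t)) × (∀ W → count (λ w → bit w (used t)) W ≤ t)
    match-candidate : ∀ t → candidateᵇ t (used t) (match t) ≡ true

    match-candidate t = proj₂ (least-∋ (candidateᵇ t (used t)) (bR (suc t))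
      (Step.candidate-exists (proj₁ (invariant t))))

    invariant zero = start , λ W → ≤-reflexive (sum-zero W λ w _ → cong 𝟙 (bit-zero w))
      where
      start : Condition 0 (λ w → bit w 0)
      start A M sup = ≤-trans (m≤m+n (count A M) _) (≤-trans (expansion A M (λ a p → proj₂ (sup a p)))
        (count-⊆ (bR M) λ w _ p → free-intro (λ w → bit w 0) A p (bit-zero w)))
    invariant (suc t) with invariant t | match-candidate t
    ... | hall , small | p =
      Condition-cong (λ w → sym (bit-insert-≡ (match t) (used t) w))
        (extend expansion hall small (∧-conicalˡ _ _ p)
          (localᵇ-sound t _ (∧-conicalʳ (not (bit (match t) (used t))) _ (∧-conicalʳ (adj t (match t)) _ p)))) ,
      λ W → ≤-trans (≤-reflexive (count-cong W λ w _ → bit-insert-≡ (match t) (used t) w))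
        (≤-trans (count-∪≤ (λ w → bit w (used t)) (_≡ᵇ match t) W)
        (≤-trans (+-mono-≤ (small W) (count-single (match t) W)) (≤-reflexive (+-comm t 1))))

    adj-match : ∀ t → adj t (match t) ≡ true
    adj-match t = ∧-conicalˡ _ _ (match-candidate t)

    match-fresh : ∀ t → bit (match t) (used t) ≡ false
    match-fresh t = not-injective (∧-conicalˡ _ _ (∧-conicalʳ (adj t (match t)) _ (match-candidate t)))

    match-used : ∀ {t u} → t < u → bit (match t) (used u) ≡ true
    match-used {t} {suc u} t<1+u = trans (bit-insert-≡ (match u) (used u) (match t))
      ([ (λ t<u → ∨-introˡ (match t ≡ᵇ match u) (match-used t<u))
       , (λ { refl → ∨-introʳ (bit (match t) (used t)) (≡ᵇ-true (match t) _ refl) }) ]′ (m≤n⇒m<n∨m≡n (≤-pred t<1+u)))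

    match-injective : ∀ {t u} → match t ≡ match u → t ≡ u
    match-injective {t} {u} eq with <-cmp t u
    ... | tri≈ _ t≡u _ = t≡u
    ... | tri< t<u _ _ = true≢false (match-used t<u) (subst (λ v → bit v (used u) ≡ false) (sym eq) (match-fresh u))
    ... | tri> _ _ u<t = true≢false (match-used u<t) (subst (λ v → bit v (used t) ≡ false) eq (match-fresh t))

  module _ (adj-C : Computable₂ (λ a w → 𝟙 (adj a w))) (bR-C : Computable₁ bR) (bL-C : Computable₁ bL) where

    horizon-C : Computable₁ horizon
    horizon-C = iter-C (app₁ bL-C (app₁ bR-C v₀)) (suc-C (suc-C v₀)) (suc-C v₀)

    candidate-C : Computable 3 (λ (t , s , v , _) → 𝟙 (candidateᵇ t s v))
    candidate-C = ∧-C (app₂ adj-C v₀ v₂) (∧-C (not-C (bit-C v₂ v₁)) (all-C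
      {P = λ c (t , s , v , _) → count (λ a → bit a c ∧ ((t <ᵇ a) ∧ (a <ᵇ horizon t))) (horizon t)
        ≤ᵇ count (free ((λ w → bit w s) ∪⁺ v) (λ a → bit a c ∧ ((t <ᵇ a) ∧ (a <ᵇ horizon t)))) (bR (horizon t))}
      (≤ᵇ-C (count-C {P = λ a (c , t , _) → bit a c ∧ ((t <ᵇ a) ∧ (a <ᵇ horizon t))}
               (sel v₀ v₁ v₂) (app₁ horizon-C v₁))
            (count-C {P = λ w (c , t , s , v , _) → free ((λ w → bit w s) ∪⁺ v) (λ a → bit a c ∧ ((t <ᵇ a) ∧ (a <ᵇ horizon t))) w}
               (∧-C (any-C {P = λ a (w , c , t , s , v , _) → (bit a c ∧ ((t <ᵇ a) ∧ (a <ᵇ horizon t))) ∧ adj a w}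
                       (∧-C (sel v₀ v₂ v₃) (app₂ adj-C v₀ v₁)) (app₁ bL-C (suc-C v₀)))
                    (not-C (∨-C (bit-C v₀ v₃) (≡ᵇ-C v₀ v₄))))
               (app₁ bR-C (app₁ horizon-C v₁))))
      (app₁ 2^-C₁ (app₁ horizon-C v₀))))
      where
      sel : ∀ {n f g h} → Computable n f → Computable n g → Computable n h →
        Computableᵇ n (λ e → bit (f e) (g e) ∧ ((h e <ᵇ f e) ∧ (f e <ᵇ horizon (h e))))
      sel cf cg ch = ∧-C (bit-C cf cg) (∧-C (<ᵇ-C ch cf) (<ᵇ-C cf (app₁ horizon-C ch)))

    pick-C : Computable₂ pick
    pick-C = least-C {P = λ v (t , s , _) → candidateᵇ t s v} (app₃ candidate-C v₁ v₂ v₀) (app₁ bR-C (suc-C v₀))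

    match-C : Computable₁ match
    match-C = app₂ pick-C v₀ (rec-C zero-C (insert-C (app₂ pick-C v₀ v₁) v₁) v₀)

-- Sizes of finite sets

enum : (ℕ → ℕ) → (ℕ → Bool) → ℕ → List ℕ
enum f P zero    = []
enum f P (suc n) = if P n then f n ∷ enum f P n else enum f P n

length-enum : ∀ f P n → length (enum f P n) ≡ count P n
length-enum f P zero = refl
length-enum f P (suc n) with P n
... | true  = trans (cong suc (length-enum f P n)) (+-comm 1 (count P n))
... | false = trans (length-enum f P n) (sym (+-identityʳ (count P n)))

∈-enum⁺ : ∀ f P {n i} → i < n → P ∋ i → f i ∈ enum f P n
∈-enum⁺ f P {suc n} {i} i<1+n p with m≤n⇒m<n∨m≡n (≤-pred i<1+n)
... | inj₂ refl rewrite p = here refl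
... | inj₁ i<n with P n
...   | true  = there (∈-enum⁺ f P i<n p)
...   | false = ∈-enum⁺ f P i<n p

∈-enum⁻ : ∀ f P n {x} → x ∈ enum f P n → ∃[ i ] i < n × P ∋ i × x ≡ f i
∈-enum⁻ f P (suc n) x∈ with dichotomy (P n)
... | inj₂ q rewrite q = let (i , i<n , p , eq) = ∈-enum⁻ f P n x∈ in i , m<n⇒m<1+n i<n , p , eq
... | inj₁ q rewrite q with x∈
...   | here eq = n , ≤-refl , q , eq
...   | there x∈′ = let (i , i<n , p , eq) = ∈-enum⁻ f P n x∈′ in i , m<n⇒m<1+n i<n , p , eq

unique-enum : ∀ f P n → (∀ {i j} → i < n → j < n → f i ≡ f j → i ≡ j) → Unique (enum f P n)
unique-enum f P zero    inj = []
unique-enum f P (suc n) inj with P n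
... | false = unique-enum f P n λ i<n j<n → inj (m<n⇒m<1+n i<n) (m<n⇒m<1+n j<n)
... | true  = All.tabulate (λ x∈ eq → let (i , i<n , _ , eq′) = ∈-enum⁻ f P n x∈ in
                <⇒≢ i<n (inj (m<n⇒m<1+n i<n) ≤-refl (trans (sym eq′) (sym eq))))
            ∷ unique-enum f P n λ i<n j<n → inj (m<n⇒m<1+n i<n) (m<n⇒m<1+n j<n)

-- The elements of `xs` are deleted from `ys` one after another; by uniqueness no later element is
-- lost.
unique⇒length≤ : ∀ {xs ys : List ℕ} → Unique xs → (∀ {x} → x ∈ xs → x ∈ ys) → length xs ≤ length ys
unique⇒length≤ [] sub = z≤n
unique⇒length≤ {x ∷ xs} (x∉ ∷ u) sub with ∈-∃++ (sub (here refl))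
... | as , bs , refl = ≤-trans (s≤s (unique⇒length≤ u keep)) (≤-reflexive (begin
    suc (length (as ++ bs))         ≡⟨ cong suc (length-++ as) ⟩
    suc (length as + length bs)     ≡⟨ sym (+-suc (length as) (length bs)) ⟩
    length as + length (x ∷ bs)     ≡⟨ sym (length-++ as) ⟩
    length (as ++ x ∷ bs)           ∎))
  where
  open ≡-Reasoning
  keep : ∀ {y} → y ∈ xs → y ∈ as ++ bs
  keep {y} y∈ with ∈-++⁻ as (sub (there y∈))
  ... | inj₁ q = ∈-++⁺ˡ q
  ... | inj₂ (here refl) = contradiction refl (All.lookup x∉ y∈)
  ... | inj₂ (there q) = ∈-++⁺ʳ as q

HasSize-count : ∀ (A : Pred ℕ 0ℓ) P n → (∀ {x} → A x → x < n × P ∋ x) → (∀ {x} → x < n → P ∋ x → A x) → A HasSize count P n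
HasSize-count A P n sound complete = enum id P n , unique-enum id P n (λ _ _ eq → eq) ,
  ((λ a → let (x<n , p) = sound a in ∈-enum⁺ id P x<n p) ,
   (λ x∈ → let (i , i<n , p , eq) = ∈-enum⁻ id P n x∈ in subst A (sym eq) (complete i<n p))) ,
  length-enum id P n

size≤count : ∀ {A : Pred ℕ 0ℓ} {k} P n → A HasSize k → (∀ {x} → A x → x < n × P ∋ x) → k ≤ count P n
size≤count P n (xs , u , (_ , back) , refl) sound = ≤-trans
  (unique⇒length≤ u λ x∈ → let (x<n , p) = sound (back x∈) in ∈-enum⁺ id P x<n p)
  (≤-reflexive (length-enum id P n))

count≤size : ∀ {A : Pred ℕ 0ℓ} {k} P n → A HasSize k → (∀ {x} → x < n → P ∋ x → A x) → count P n ≤ k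
count≤size {A} P n (xs , u , (fore , _) , refl) complete = ≤-trans (≤-reflexive (sym (length-enum id P n)))
  (unique⇒length≤ (unique-enum id P n λ _ _ eq → eq) λ x∈ →
    let (i , i<n , p , eq) = ∈-enum⁻ id P n x∈ in fore (subst A (sym eq) (complete i<n p)))

-- Cutting and pruning the parent function

∨-false : ∀ {x y} → x ∨ y ≡ false → x ≡ false × y ≡ false
∨-false {false} p = refl , p

Periodic : (ℕ → ℕ) → ℕ → Set
Periodic f x = ∃[ i ] iter f (suc i) x ≡ x

iter-periodic : ∀ f i x → iter f i x ≡ x → ∀ k → iter f (k * i) x ≡ x
iter-periodic f i x h zero    = refl
iter-periodic f i x h (suc k) = trans (iter-+ f i (k * i) x) (trans (cong (iter f i) (iter-periodic f i x h k)) h)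

-- The product of the periods brings both points back to themselves, while their walks agree from
-- the first step on. Hence a parent has at most one child on a cycle.
periodic-unique : ∀ f {x y} → Periodic f x → Periodic f y → f x ≡ f y → x ≡ y
periodic-unique f {x} {y} (i , hx) (j , hy) eq = begin
  x                           ≡⟨ sym (iter-periodic f (suc i) x hx (suc j)) ⟩
  iter f (suc j * suc i) x    ≡⟨ sym (iter-comm f (i + j * suc i) x) ⟩
  iter f (i + j * suc i) (f x) ≡⟨ cong (iter f (i + j * suc i)) eq ⟩
  iter f (i + j * suc i) (f y) ≡⟨ iter-comm f (i + j * suc i) y ⟩
  iter f (suc j * suc i) y    ≡⟨ cong (λ k → iter f k y) (*-comm (suc j) (suc i)) ⟩
  iter f (suc i * suc j) y    ≡⟨ iter-periodic f (suc j) y hy (suc i) ⟩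
  y                           ∎
  where open ≡-Reasoning

iter-swap : ∀ f m n x → iter f m (iter f n x) ≡ iter f n (iter f m x)
iter-swap f m n x = trans (sym (iter-+ f m n x)) (trans (cong (λ k → iter f k x) (+-comm m n)) (iter-+ f n m x))

repeat⇒periodic : ∀ f x {i j n} → i < j → i ≤ n → iter f i x ≡ iter f j x → Periodic f (iter f n x)
repeat⇒periodic f x {i} {j} {n} i<j i≤n eq = j ∸ suc i , (begin
  iter f e (iter f n x)             ≡⟨ cong (λ k → iter f e (iter f k x)) (sym (m∸n+n≡m i≤n)) ⟩
  iter f e (iter f (n ∸ i + i) x)   ≡⟨ cong (iter f e) (iter-+ f (n ∸ i) i x) ⟩
  iter f e (iter f (n ∸ i) (iter f i x)) ≡⟨ iter-swap f e (n ∸ i) (iter f i x) ⟩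
  iter f (n ∸ i) (iter f e (iter f i x)) ≡⟨ cong (iter f (n ∸ i)) (sym (iter-+ f e i x)) ⟩
  iter f (n ∸ i) (iter f (e + i) x) ≡⟨ cong (λ k → iter f (n ∸ i) (iter f k x)) (trans (sym (+-suc (j ∸ suc i) i)) (m∸n+n≡m i<j)) ⟩
  iter f (n ∸ i) (iter f j x)       ≡⟨ cong (iter f (n ∸ i)) (sym eq) ⟩
  iter f (n ∸ i) (iter f i x)       ≡⟨ sym (iter-+ f (n ∸ i) i x) ⟩
  iter f (n ∸ i + i) x              ≡⟨ cong (λ k → iter f k x) (m∸n+n≡m i≤n) ⟩
  iter f n x                        ∎)
  where
  open ≡-Reasoning
  e = suc (j ∸ suc i)

-- The largest solution is split off; three applications extract three distinct ones.
count-pop : ∀ P n {k} → suc k ≤ count P n → ∃[ i ] i < n × P ∋ i × k ≤ count P i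
count-pop P (suc n) le with dichotomy (P n)
... | inj₁ p rewrite p | +-comm (count P n) 1 = n , ≤-refl , p , ≤-pred le
... | inj₂ p rewrite p | +-identityʳ (count P n) with count-pop P n le
...   | i , i<n , q , r = i , m<n⇒m<1+n i<n , q , r

count-not : ∀ P n → count P n + count (not ∘ P) n ≡ n
count-not P zero    = refl
count-not P (suc n) = trans (+-interchange (count P n) _ _ _)
  (trans (cong₂ _+_ (count-not P n) (one (P n))) (+-comm n 1))
  where
  one : ∀ x → 𝟙 x + 𝟙 (not x) ≡ 1
  one true  = refl
  one false = refl

-- Solutions are accepted in increasing order until there are `k` of them.
count-first : ∀ P k n → count (λ i → P i ∧ (count P i <ᵇ k)) n ≡ count P n ⊓ k
count-first P k zero = refl
count-first P k (suc n) rewrite count-first P k n with P n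
... | false rewrite +-identityʳ (count P n ⊓ k) | +-identityʳ (count P n) = refl
... | true with dichotomy (count P n <ᵇ k)
...   | inj₁ q rewrite q | +-comm (count P n) 1 | +-comm (count P n ⊓ k) 1 = let lt = <ᵇ-true⁻¹ _ k q in
        trans (cong suc (m≤n⇒m⊓n≡m (<⇒≤ lt))) (sym (m≤n⇒m⊓n≡m lt))
...   | inj₂ q rewrite q | +-comm (count P n) 1 | +-identityʳ (count P n ⊓ k) = let ge = <ᵇ-false⁻¹ q in
        trans (m≥n⇒m⊓n≡n ge) (sym (m≥n⇒m⊓n≡n (≤-trans ge (n≤1+n _))))

-- `p` and `ix` invert `child` except at orphans, where their values carry no meaning.
module Forest
  (d : ℕ) (child : ℕ → ℕ → ℕ) (p ix : ℕ → ℕ) (orphan : ℕ → Bool)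
  (p-child : ∀ u {i} → i < 2 + d → p (child u i) ≡ u)
  (ix-child : ∀ u {i} → i < 2 + d → ix (child u i) ≡ i)
  (child-legitimate : ∀ u {i} → i < 2 + d → orphan (child u i) ≡ false)
  (child-p : ∀ w → orphan w ≡ false → child (p w) (ix w) ≡ w)
  (ix-bound : ∀ w → orphan w ≡ false → ix w < 2 + d)
  where

  D : ℕ
  D = 2 + d

  bereft : ℕ → ℕ → Bool
  bereft s u = any (λ i → bit (child u i) s) D

  stop : ℕ → ℕ → ℕ → Bool
  stop n s x = (x <ᵇ n) ∨ (orphan x ∨ (bit x s ∨ not (bereft s (p x))))

  -- `least` defaults to `n`, so an undecided walk is broken off after `n` steps. Unless it stops
  -- there as well, it has then reached a cycle.
  end : ℕ → ℕ → ℕ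
  end n s = iter p (least (λ j → stop n s (iter p j n)) n) n

  -- Below `n`, earlier stages have already provided for a cut. Inserting an orphan or a member of
  -- `s` does not affect which vertices count as cut.
  next : ℕ → ℕ → ℕ
  next n s = if end n s <ᵇ n then s else insert (end n s) s

  opaque
    cuts : ℕ → ℕ
    cuts = rec 0 next

    cuts-zero : cuts 0 ≡ 0
    cuts-zero = refl

    cuts-suc : ∀ n → cuts (suc n) ≡ next n (cuts n)
    cuts-suc n = refl

    cuts-C : Computable₂ next → Computable₁ cuts
    cuts-C next-C = rec-C zero-C (app₂ next-C v₀ v₁) v₀

  -- Stage `n` inserts only vertices from `n` on, so the fate of `w` is settled once stage `w` is
  -- over.
  cut : ℕ → Bool
  cut w = orphan w ∨ bit w (cuts (suc w))

  newcomer : ℕ → ℕ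
  newcomer n = end n (cuts n)

  bit-next : ∀ n s w → n ≤ end n s → bit w (next n s) ≡ bit w s ∨ (w ≡ᵇ end n s)
  bit-next n s w le with dichotomy (end n s <ᵇ n)
  ... | inj₁ q = contradiction le (<⇒≱ (<ᵇ-true⁻¹ _ n q))
  ... | inj₂ q = trans (cong (λ b → bit w (if b then s else insert (end n s) s)) q) (bit-insert-≡ (end n s) s w)

  next-idle : ∀ n s → end n s < n → next n s ≡ s
  next-idle n s lt = cong (λ b → if b then s else insert (end n s) s) (<ᵇ-true lt)

  cuts-suc⁻¹ : ∀ w n → bit w (cuts (suc n)) ≡ true → bit w (cuts n) ≡ true ⊎ (w ≡ newcomer n × n ≤ w)
  cuts-suc⁻¹ w n b with <-≤-connex (newcomer n) n
  ... | inj₁ lt = inj₁ (subst (λ s → bit w s ≡ true) (trans (cuts-suc n) (next-idle n (cuts n) lt)) b)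
  ... | inj₂ ge = [ inj₁ , (λ r → let eq = ≡ᵇ-true⁻¹ w (newcomer n) r in inj₂ (eq , subst (n ≤_) (sym eq) ge)) ]′
    (∨-elim (bit w (cuts n)) (trans (sym (bit-next n (cuts n) w ge)) (subst (λ s → bit w s ≡ true) (cuts-suc n) b)))

  cuts-grow : ∀ w n → bit w (cuts n) ≡ true → bit w (cuts (suc n)) ≡ true
  cuts-grow w n b = trans (cong (bit w) (cuts-suc n)) (grow (<-≤-connex (newcomer n) n))
    where
    grow : newcomer n < n ⊎ n ≤ newcomer n → bit w (next n (cuts n)) ≡ true
    grow (inj₁ lt) = trans (cong (bit w) (next-idle n (cuts n) lt)) b
    grow (inj₂ ge) = trans (bit-next n (cuts n) w ge) (∨-introˡ (w ≡ᵇ newcomer n) b)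

  cuts-newcomer : ∀ n → n ≤ newcomer n → bit (newcomer n) (cuts (suc n)) ≡ true
  cuts-newcomer n ge = trans (cong (bit (newcomer n)) (cuts-suc n)) (trans (bit-next n (cuts n) (newcomer n) ge)
    (∨-introʳ (bit (newcomer n) (cuts n)) (≡ᵇ-true (newcomer n) _ refl)))

  cuts-mono : ∀ w {m n} → m ≤ n → bit w (cuts m) ≡ true → bit w (cuts n) ≡ true
  cuts-mono w {m} {n} m≤n b = subst (λ k → bit w (cuts k) ≡ true) (m∸n+n≡m m≤n) (go (n ∸ m))
    where
    go : ∀ k → bit w (cuts (k + m)) ≡ true
    go zero    = b
    go (suc k) = cuts-grow w (k + m) (go k)

  cuts-decided : ∀ w n → bit w (cuts n) ≡ true → bit w (cuts (suc w)) ≡ true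
  cuts-decided w zero    b = true≢false b (trans (cong (bit w) cuts-zero) (bit-zero w))
  cuts-decided w (suc n) b with cuts-suc⁻¹ w n b
  ... | inj₁ b′ = cuts-decided w n b′
  ... | inj₂ (_ , n≤w) = cuts-mono w (s≤s n≤w) b

  cuts-entry : ∀ w n → bit w (cuts n) ≡ true → ∃[ m ] m < n × w ≡ newcomer m
  cuts-entry w zero    b = true≢false b (trans (cong (bit w) cuts-zero) (bit-zero w))
  cuts-entry w (suc n) b with cuts-suc⁻¹ w n b
  ... | inj₂ (eq , _) = n , ≤-refl , eq
  ... | inj₁ b′ with cuts-entry w n b′
  ...   | m , m<n , eq = m , m<n⇒m<1+n m<n , eq

  descends : ∀ n → ∃[ j ] j ≤ n × (iter p j n < n ⊎ cut (iter p j n) ≡ true)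
  descends n = least (λ j → stop n (cuts n) (iter p j n)) n , least-≤ (λ j → stop n (cuts n) (iter p j n)) n , decide
    where
    decide : newcomer n < n ⊎ cut (newcomer n) ≡ true
    decide with <-≤-connex (newcomer n) n
    ... | inj₁ lt = inj₁ lt
    ... | inj₂ ge = inj₂ (∨-introʳ (orphan (newcomer n)) (cuts-decided (newcomer n) (suc n) (cuts-newcomer n ge)))

  ReachesCut : ℕ → Set
  ReachesCut n = ∃[ l ] l ≤ n * n × cut (iter p l n) ≡ true

  -- At most `n` steps lead to a cut or below `n`, and (n - 1)² + n ≤ n² for positive n.
  reaches-cut : ∀ n → ReachesCut n
  reaches-cut = <-rec ReachesCut λ n rec-hyp → step n rec-hyp (descends n)
    where
    n≤n*n : ∀ n → n ≤ n * n
    n≤n*n zero    = z≤n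
    n≤n*n (suc n) = m≤m*n (suc n) (suc n)
    bound : ∀ {l m j n} → l ≤ m * m → m < n → j ≤ n → l + j ≤ n * n
    bound {l} {m} {j} {suc n} l≤ (s≤s m≤n) j≤ = begin
      l + j ≤⟨ +-mono-≤ (≤-trans l≤ (*-mono-≤ m≤n (≤-trans m≤n (n≤1+n n)))) j≤ ⟩
      n * suc n + suc n ≡⟨ +-comm (n * suc n) (suc n) ⟩
      suc n * suc n ∎
      where open ≤-Reasoning
    step : ∀ n → (∀ {m} → m < n → ReachesCut m) →
      ∃[ j ] j ≤ n × (iter p j n < n ⊎ cut (iter p j n) ≡ true) → ReachesCut n
    step n rec-hyp (j , j≤n , inj₂ c)  = j , ≤-trans j≤n (n≤n*n n) , c
    step n rec-hyp (j , j≤n , inj₁ lt) = let (l , l≤ , c) = rec-hyp lt in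
      l + j , bound l≤ lt j≤n , subst (λ z → cut z ≡ true) (sym (iter-+ p l j n)) c

  stop-false : ∀ n s x → stop n s x ≡ false →
    n ≤ x × orphan x ≡ false × bit x s ≡ false × bereft s (p x) ≡ true
  stop-false n s x h with ∨-false {x <ᵇ n} h
  ... | a , h₁ with ∨-false {orphan x} h₁
  ...   | b , h₂ with ∨-false {bit x s} h₂
  ...     | c , h₃ = <ᵇ-false⁻¹ a , b , c , not-injective h₃

  bereft-intro : ∀ {s u w} → orphan w ≡ false → p w ≡ u → bit w s ≡ true → bereft s u ≡ true
  bereft-intro {s} {u} {w} o refl b = any-intro (λ i → bit (child u i) s) (ix-bound w o)
    (subst (λ z → bit z s ≡ true) (sym (child-p w o)) b)

  -- Distinct stages account for distinct bereft vertices, so a walk through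
  -- more bereft vertices than there were stages repeats itself.
  bereft-walk : ∀ n x → (∀ j → j ≤ n → bereft (cuts n) (iter p (suc j) x) ≡ true) → Periodic p (iter p n x)
  bereft-walk n x h = conclude (pigeonhole (n<1+n n) (λ j → fromℕ< (proj₁ (proj₂ (source (toℕ j) (≤-pred (toℕ<n j)))))))
    where
    source : ∀ j → j ≤ n → ∃[ m ] m < n × p (newcomer m) ≡ iter p (suc j) x
    source j j≤n =
      let (i , i<D , b) = any-elim (λ i → bit (child (iter p (suc j) x) i) (cuts n)) D (h j j≤n)
          (m , m<n , eq) = cuts-entry (child (iter p (suc j) x) i) n b
      in m , m<n , trans (cong p (sym eq)) (p-child _ i<D)
    conclude : _ → Periodic p (iter p n x)
    conclude (i , j , i<j , eq) =
      let (m , m<n , e) = source (toℕ i) (≤-pred (toℕ<n i))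
          (m′ , m′<n , e′) = source (toℕ j) (≤-pred (toℕ<n j))
      in repeat⇒periodic p x {suc (toℕ i)} {suc (toℕ j)} (s≤s i<j) (≤-trans i<j (≤-pred (toℕ<n j)))
           (trans (sym e) (trans (cong (p ∘ newcomer) (fromℕ<-injective m m′ m<n m′<n eq)) e′))

  -- No reason to stop holds at the end, so the walk was broken off after `n` steps and met only
  -- bereft parents.
  late-newcomer-periodic : ∀ n → n ≤ newcomer n → orphan (newcomer n) ≡ false →
    bit (newcomer n) (cuts n) ≡ false → bereft (cuts n) (p (newcomer n)) ≡ true → Periodic p (newcomer n)
  late-newcomer-periodic n le o b c = subst (λ k → Periodic p (iter p k n)) (sym at-end)
    (bereft-walk n n λ j j≤n → proj₂ (proj₂ (proj₂ (stop-false n (cuts n) (iter p j n) (walking j j≤n)))))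
    where
    P : ℕ → Bool
    P j = stop n (cuts n) (iter p j n)
    end-walking : P (least P n) ≡ false
    end-walking = ¬-not λ h → [ (λ q → <⇒≱ (<ᵇ-true⁻¹ (newcomer n) n q) le) ,
      (λ h₁ → [ (λ q → true≢false q o) , (λ h₂ → [ (λ q → true≢false q b) ,
        (λ q → true≢false c (not-injective q)) ]′ (∨-elim (bit (newcomer n) (cuts n)) h₂)) ]′
        (∨-elim (orphan (newcomer n)) h₁)) ]′ (∨-elim (newcomer n <ᵇ n) h)
    at-end : least P n ≡ n
    at-end = least-none P n (¬-not λ q → true≢false (proj₂ (least-∋ P n q)) end-walking)
    walking : ∀ j → j ≤ n → P j ≡ false
    walking j j≤n with m≤n⇒m<n∨m≡n j≤n
    ... | inj₁ j<n = least-minimal P n (subst (j <_) (sym at-end) j<n)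
    ... | inj₂ refl = subst (λ k → P k ≡ false) at-end end-walking

  Cut : ℕ → ℕ → Set
  Cut n w = bit w (cuts n) ≡ true × orphan w ≡ false

  -- The sibling inserted later found its parent already bereft, so only the cycle rule can have
  -- selected it.
  cut-siblings : ∀ n {w w′} → Cut n w → Cut n w′ → p w ≡ p w′ → w ≢ w′ → Periodic p w ⊎ Periodic p w′
  cut-siblings zero {w} (b , _) _ _ _ = true≢false b (trans (cong (bit w) cuts-zero) (bit-zero w))
  cut-siblings (suc n) {w} {w′} (b , o) (b′ , o′) eq w≢w′ = cases (old? b) (old? b′)
    where
    old? : ∀ {x} → bit x (cuts (suc n)) ≡ true →
      bit x (cuts n) ≡ true ⊎ (bit x (cuts n) ≡ false × x ≡ newcomer n × n ≤ x)
    old? {x} q with dichotomy (bit x (cuts n))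
    ... | inj₁ r = inj₁ r
    ... | inj₂ r = [ (λ y → true≢false y r) , (λ y → inj₂ (r , y)) ]′ (cuts-suc⁻¹ x n q)
    late : ∀ {x y} → bit x (cuts n) ≡ false × x ≡ newcomer n × n ≤ x → orphan x ≡ false → Cut n y → p y ≡ p x → Periodic p x
    late (r , refl , ge) ox (q , oy) e = late-newcomer-periodic n ge ox r (bereft-intro oy e q)
    cases : bit w (cuts n) ≡ true ⊎ _ → bit w′ (cuts n) ≡ true ⊎ _ → Periodic p w ⊎ Periodic p w′
    cases (inj₁ c) (inj₁ c′) = cut-siblings n (c , o) (c′ , o′) eq w≢w′
    cases (inj₁ c) (inj₂ x′) = inj₂ (late x′ o′ (c , o) eq)
    cases (inj₂ x) (inj₁ c′) = inj₁ (late x o (c′ , o′) (sym eq))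
    cases (inj₂ (_ , e , _)) (inj₂ (_ , e′ , _)) = contradiction (trans e (sym e′)) w≢w′

  child-injective : ∀ u {i j} → i < D → j < D → child u i ≡ child u j → i ≡ j
  child-injective u i<D j<D eq = trans (sym (ix-child u i<D)) (trans (cong ix eq) (ix-child u j<D))

  -- Among three cut siblings every pair contains one on a cycle, so two of them would lie on
  -- cycles, against `periodic-unique`.
  at-most-two-cut : ∀ u → count (λ i → cut (child u i)) D ≤ 2
  at-most-two-cut u = ≮⇒≥ λ many →
    let P = λ i → cut (child u i)
        (k , k<D , ck , m₁) = count-pop P D many
        (j , j<k , cj , m₂) = count-pop P k m₁
        (i , i<j , ci , _)  = count-pop P j m₂
        j<D = <-trans j<k k<D
        i<D = <-trans i<j j<D
        a = child u i
        b = child u j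
        c = child u k
        -- A stage beyond all three vertices, at which each of them has been decided.
        M = suc a + (suc b + suc c)
        a∈ = member i<D ci {M} (m≤m+n _ _)
        b∈ = member j<D cj {M} (≤-trans (m≤m+n (suc b) (suc c)) (m≤n+m _ (suc a)))
        c∈ = member k<D ck {M} (≤-trans (m≤n+m (suc c) (suc b)) (m≤n+m _ (suc a)))
        a≢b = <⇒≢ i<j ∘ child-injective u i<D j<D
        b≢c = <⇒≢ j<k ∘ child-injective u j<D k<D
        a≢c = <⇒≢ (<-trans i<j j<k) ∘ child-injective u i<D k<D
        ab = siblings i<D j<D
        bc = siblings j<D k<D
        ac = siblings i<D k<D
        not-both = λ {x y} (eq : p x ≡ p y) (ne : x ≢ y) px py → ne (periodic-unique p px py eq)
    in [ (λ pa → [ (λ pb → not-both ab a≢b pa pb) , (λ pc → not-both ac a≢c pa pc) ]′ (cut-siblings M b∈ c∈ bc b≢c))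
       , (λ pb → [ (λ pa → not-both ab a≢b pa pb) , (λ pc → not-both bc b≢c pb pc) ]′ (cut-siblings M a∈ c∈ ac a≢c)) ]′
       (cut-siblings M a∈ b∈ ab a≢b)
    where
    member : ∀ {i} → i < D → cut (child u i) ≡ true → ∀ {M} → child u i < M → Cut M (child u i)
    member {i} i<D c lt = [ (λ o → true≢false o (child-legitimate u i<D)) , cuts-mono (child u i) lt ]′ (∨-elim (orphan (child u i)) c)
      , child-legitimate u i<D
    siblings : ∀ {i j} → i < D → j < D → p (child u i) ≡ p (child u j)
    siblings i<D j<D = trans (p-child u i<D) (sym (p-child u j<D))

  -- Pruning surplus children

  rank : ℕ → ℕ
  rank w = count (λ i → not (cut (child (p w) i))) (ix w)

  -- The first argument is fuel; it does not matter once it exceeds the distance to a cut.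
  retain : ℕ → ℕ → Bool
  retain zero    w = false
  -- The first `d` uncut children survive, or the first `d - 1` if the parent keeps its own parent
  -- edge as one of its `d` edges.
  retain (suc k) w = not (cut w) ∧ (rank w <ᵇ d ∸ 𝟙 (retain k (p w)))

  retain-stable : ∀ l w → cut (iter p l w) ≡ true → ∀ {k k′} → l < k → l < k′ → retain k w ≡ retain k′ w
  retain-stable zero    w c (s≤s _) (s≤s _) rewrite c = refl
  retain-stable (suc l) w c (s≤s l<k) (s≤s l<k′) = cong (λ b → not (cut w) ∧ (rank w <ᵇ d ∸ 𝟙 b))
    (retain-stable l (p w) (trans (cong cut (iter-comm p l w)) c) l<k l<k′)

  opaque
    retained : ℕ → Bool
    retained w = retain (suc (w * w)) w

    -- The fuels at `w` and at `p w` are unrelated numbers; both exceed the shorter of the two known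
    -- distances from `p w` to a cut.
    retained-unfold : ∀ w → retained w ≡ not (cut w) ∧ (rank w <ᵇ d ∸ 𝟙 (retained (p w)))
    retained-unfold w with reaches-cut w | reaches-cut (p w)
    ... | zero  , _ , c | _ rewrite c = refl
    ... | suc l , l≤ , c | l′ , l′≤ , c′ = cong (λ b → not (cut w) ∧ (rank w <ᵇ d ∸ 𝟙 b)) (stable (≤-total l l′))
      where
      stable : l ≤ l′ ⊎ l′ ≤ l → retain (w * w) (p w) ≡ retain (suc (p w * p w)) (p w)
      stable (inj₁ le) = retain-stable l (p w) (trans (cong cut (iter-comm p l w)) c) l≤ (s≤s (≤-trans le l′≤))
      stable (inj₂ le) = retain-stable l′ (p w) c′ (≤-trans (s≤s le) l≤) (s≤s l′≤)

  cut⇒¬retained : ∀ w → cut w ≡ true → retained w ≡ false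
  cut⇒¬retained w c = trans (retained-unfold w) (cong (λ b → not b ∧ (rank w <ᵇ d ∸ 𝟙 (retained (p w)))) c)

  retained⇒legitimate : ∀ {w} → retained w ≡ true → orphan w ≡ false
  retained⇒legitimate {w} r = ¬-not λ o → true≢false r (cut⇒¬retained w (∨-introˡ (bit w (cuts (suc w))) o))

  retained-children : ∀ u → count (λ i → retained (child u i)) D ≡ d ∸ 𝟙 (retained u)
  retained-children u = begin
    count (λ i → retained (child u i)) D ≡⟨ count-cong D (λ i i<D → unfold i<D) ⟩
    count (λ i → kept i ∧ (count kept i <ᵇ d ∸ 𝟙 (retained u))) D ≡⟨ count-first kept (d ∸ 𝟙 (retained u)) D ⟩
    count kept D ⊓ (d ∸ 𝟙 (retained u)) ≡⟨ m≥n⇒m⊓n≡n (≤-trans (m∸n≤m d (𝟙 (retained u))) enough) ⟩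
    d ∸ 𝟙 (retained u) ∎
    where
    open ≡-Reasoning
    kept : ℕ → Bool
    kept i = not (cut (child u i))
    unfold : ∀ {i} → i < D → retained (child u i) ≡ kept i ∧ (count kept i <ᵇ d ∸ 𝟙 (retained u))
    unfold {i} i<D = trans (retained-unfold (child u i)) (cong (kept i ∧_)
      (cong₂ (λ v j → count (λ i → not (cut (child v i))) j <ᵇ d ∸ 𝟙 (retained v)) (p-child u i<D) (ix-child u i<D)))
    enough : d ≤ count kept D
    enough = +-cancelˡ-≤ 2 d (count kept D) (≤-trans (≤-reflexive (sym (count-not (λ i → cut (child u i)) D)))
      (+-monoˡ-≤ (count kept D) (at-most-two-cut u)))

  -- Heights and roots

  opaque
    height : ℕ → ℕ
    height w = least (λ l → not (retained (iter p l w))) (suc (w * w))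

    height-top : ∀ w → retained (iter p (height w) w) ≡ false
    height-top w = let (l , l≤ , c) = reaches-cut w in not-injective (proj₂
      (least-∋ (λ l → not (retained (iter p l w))) (suc (w * w))
        (any-intro (λ l → not (retained (iter p l w))) (s≤s l≤) (not-true (cut⇒¬retained (iter p l w) c)))))

    height-below : ∀ w {i} → i < height w → retained (iter p i w) ≡ true
    height-below w lt = not-injective (least-minimal (λ l → not (retained (iter p l w))) (suc (w * w)) lt)

  height-unique : ∀ w h → retained (iter p h w) ≡ false → (∀ {i} → i < h → retained (iter p i w) ≡ true) → height w ≡ h
  height-unique w h top below = ≤-antisym
    (≮⇒≥ λ lt → true≢false (height-below w lt) top)
    (≮⇒≥ λ lt → true≢false (below lt) (height-top w))

  height-parent : ∀ {w} → retained w ≡ true → height w ≡ suc (height (p w))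
  height-parent {w} r = height-unique w (suc (height (p w)))
    (trans (cong retained (sym (iter-comm p (height (p w)) w))) (height-top (p w))) below
    where
    below : ∀ {i} → i < suc (height (p w)) → retained (iter p i w) ≡ true
    below {zero}  _        = r
    below {suc i} (s≤s lt) = trans (cong retained (sym (iter-comm p i w))) (height-below (p w) lt)

  up : ℕ → ℕ
  up w = if retained w then p w else w

  -- Surplus iterations are harmless, since `up` is stationary at a vertex without a kept parent
  -- edge.
  root : ℕ → ℕ
  root w = iter up (w * w) w

  up-retained : ∀ {w} → retained w ≡ true → up w ≡ p w
  up-retained {w} r = cong (λ b → if b then p w else w) r

  up-top : ∀ {w} → retained w ≡ false → up w ≡ w
  up-top {w} r = cong (λ b → if b then p w else w) r

  iter-up-top : ∀ {w} → retained w ≡ false → ∀ k → iter up k w ≡ w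
  iter-up-top r zero    = refl
  iter-up-top r (suc k) = trans (cong up (iter-up-top r k)) (up-top r)

  iter-up-stable : ∀ l w → retained (iter p l w) ≡ false → ∀ {k k′} → l ≤ k → l ≤ k′ → iter up k w ≡ iter up k′ w
  iter-up-stable zero w r {k} {k′} _ _ = trans (iter-up-top r k) (sym (iter-up-top r k′))
  iter-up-stable (suc l) w r {suc k} {suc k′} (s≤s l≤k) (s≤s l≤k′) = [ below , (λ t → trans (iter-up-top t (suc k)) (sym (iter-up-top t (suc k′)))) ]′ (dichotomy (retained w))
    where
    below : retained w ≡ true → iter up (suc k) w ≡ iter up (suc k′) w
    below t = trans (sym (iter-comm up k w)) (trans (cong (iter up k) (up-retained t))
      (trans (iter-up-stable l (p w) (trans (cong retained (iter-comm p l w)) r) l≤k l≤k′)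
      (trans (cong (iter up k′) (sym (up-retained t))) (iter-comm up k′ w))))

  -- Both sides are prolonged to the same walk: `p w * p w + w * w` steps from the parent are one
  -- step more from `w`, and this is enough for either.
  root-parent : ∀ {w} → retained w ≡ true → root (p w) ≡ root w
  root-parent {w} r with reaches-cut w | reaches-cut (p w)
  ... | zero  , _ , c | _ = true≢false r (cut⇒¬retained w c)
  ... | suc l , l≤ , c | l′ , l′≤ , c′ = trans (iter-up-stable l′ (p w) (cut⇒¬retained (iter p l′ (p w)) c′) {k′ = (p w * p w) + w * w} l′≤ (≤-trans l′≤ (m≤m+n _ _)))
    (trans (cong (iter up (p w * p w + w * w)) (sym (up-retained r)))
    (trans (iter-comm up (p w * p w + w * w) w)
    (sym (iter-up-stable (suc l) w (cut⇒¬retained (iter p (suc l) w) c) {k′ = suc (p w * p w + w * w)} l≤ (≤-trans l≤ (≤-trans (m≤n+m (w * w) (p w * p w)) (n≤1+n _)))))))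

  -- Acyclicity, degrees and components of the forest

  Edge : Rel ℕ 0ℓ
  Edge m n = retained n ≡ true × p n ≡ m

  height-edge : ∀ {m n} → Edge m n → height n ≡ suc (height m)
  height-edge (r , refl) = height-parent r

  NonBacktracking : List ℕ → Set
  NonBacktracking (x ∷ y ∷ z ∷ zs) = x ≢ z × NonBacktracking (y ∷ z ∷ zs)
  NonBacktracking _ = ⊤

  lastOf : ℕ → List ℕ → ℕ
  lastOf x []       = x
  lastOf x (y ∷ ys) = lastOf y ys

  lastOf-∈ : ∀ x xs → lastOf x xs ∈ x ∷ xs
  lastOf-∈ x []       = here refl
  lastOf-∈ x (y ∷ ys) = there (lastOf-∈ y ys)

  -- After a step down the only way up is back, so the walk keeps going down.
  walk-down : ∀ a b ys z → Edge a b → Linked (SymClosure Edge) (b ∷ ys ∷ʳ z) → NonBacktracking (a ∷ b ∷ ys ∷ʳ z) →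
    height a < height z × p z ≡ lastOf b ys
  walk-down a b [] z ab (fwd bz ∷ _) nb = ≤-trans (≤-reflexive (sym (height-edge ab)))
    (≤-trans (n≤1+n _) (≤-reflexive (sym (height-edge bz)))) , proj₂ bz
  walk-down a b [] z ab (bwd zb ∷ _) nb = contradiction (trans (sym (proj₂ ab)) (proj₂ zb)) (proj₁ nb)
  walk-down a b (c ∷ ys) z ab (fwd bc ∷ l) nb = let (lt , eq) = walk-down b c ys z bc l (proj₂ nb) in
    <-trans (≤-reflexive (sym (height-edge ab))) lt , eq
  walk-down a b (c ∷ ys) z ab (bwd cb ∷ l) nb = contradiction (trans (sym (proj₂ ab)) (proj₂ cb)) (proj₁ nb)

  -- A walk that climbs all the way loses height; after a first step down it goes down to the end,
  -- so its last step comes from the parent of `z`.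
  walk-any : ∀ a ys z → Linked (SymClosure Edge) (a ∷ ys ∷ʳ z) → NonBacktracking (a ∷ ys ∷ʳ z) →
    height z < height a ⊎ p z ≡ lastOf a ys
  walk-any a [] z (fwd az ∷ _) nb = inj₂ (proj₂ az)
  walk-any a [] z (bwd za ∷ _) nb = inj₁ (≤-reflexive (sym (height-edge za)))
  walk-any a (c ∷ ys) z (fwd ac ∷ l) nb = inj₂ (proj₂ (walk-down a c ys z ac l nb))
  walk-any a (c ∷ []) z (bwd ca ∷ l) nb = up-then (walk-any c [] z l _)
    where
    up-then : height z < height c ⊎ p z ≡ c → height z < height a ⊎ p z ≡ c
    up-then = [ (λ lt → inj₁ (<-trans lt (≤-reflexive (sym (height-edge ca))))) , inj₂ ]′
  walk-any a (c ∷ e ∷ ys) z (bwd ca ∷ l) nb =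
    [ (λ lt → inj₁ (<-trans lt (≤-reflexive (sym (height-edge ca))))) , inj₂ ]′ (walk-any c (e ∷ ys) z l (proj₂ nb))

  unique⇒nonBacktracking : ∀ a b ys z → Unique (a ∷ b ∷ ys) → All (_≢ z) (a ∷ b ∷ ys) → NonBacktracking (a ∷ b ∷ ys ∷ʳ z)
  unique⇒nonBacktracking a b []       z u (a≢z ∷ _) = a≢z , _
  unique⇒nonBacktracking a b (c ∷ ys) z ((_ ∷ a≢c ∷ _) ∷ u) (_ ∷ ≢z) = a≢c , unique⇒nonBacktracking b c ys z u ≢z

  -- A cycle starting downwards would gain height all the way round. One starting upwards has to
  -- come back down to `x` through its parent `y`, which would then occur twice.
  acyclic : Acyclic Edge
  acyclic x [] u len (fwd e ∷ _) = 1+n≢n (sym (height-edge e))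
  acyclic x [] u len (bwd e ∷ _) = 1+n≢n (sym (height-edge e))
  acyclic x (y ∷ []) u len l = len refl
  acyclic x (y ∷ z ∷ zs) ((x≢y ∷ x≢z ∷ x≢zs) ∷ u@(y≢ ∷ _)) len (s ∷ l) = first s
    where
    ≢x : All (_≢ x) (y ∷ z ∷ zs)
    ≢x = All.map (λ ne eq → ne (sym eq)) (x≢y ∷ x≢z ∷ x≢zs)
    nb : NonBacktracking (y ∷ z ∷ zs ∷ʳ x)
    nb = unique⇒nonBacktracking y z zs x u ≢x
    first : SymClosure Edge x y → ⊥
    first (fwd xy) = <-irrefl refl (proj₁ (walk-down x y (z ∷ zs) x xy l (x≢z , nb)))
    first (bwd yx) = [ (λ lt → <-asym lt (≤-reflexive (sym (height-edge yx))))
                     , (λ eq → All.lookup y≢ (lastOf-∈ z zs) (trans (sym (proj₂ yx)) eq)) ]′ (walk-any y (z ∷ zs) x l nb)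

  kids : ℕ → List ℕ
  kids u = enum (child u) (λ i → retained (child u i)) D

  kids-unique : ∀ u → Unique (kids u)
  kids-unique u = unique-enum (child u) (λ i → retained (child u i)) D (child-injective u)

  ∈-kids⁻ : ∀ u {n} → n ∈ kids u → Edge u n
  ∈-kids⁻ u n∈ with ∈-enum⁻ (child u) (λ i → retained (child u i)) D n∈
  ... | i , i<D , r , refl = r , p-child u i<D

  ∈-kids⁺ : ∀ {u n} → Edge u n → n ∈ kids u
  ∈-kids⁺ {u} {n} (r , refl) = let o = retained⇒legitimate r in
    subst (_∈ kids (p n)) (child-p n o) (∈-enum⁺ (child (p n)) (λ i → retained (child (p n) i)) (ix-bound n o)
      (subst (λ z → retained z ≡ true) (sym (child-p n o)) r))

  regular : 1 ≤ d → ∀ u → SymClosure Edge u HasSize d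
  regular 1≤d u with retained u in eq
  ... | false = kids u , kids-unique u ,
    ((λ { (fwd e) → ∈-kids⁺ e ; (bwd (r , _)) → true≢false r eq }) , (λ n∈ → fwd (∈-kids⁻ u n∈))) ,
    trans (length-enum (child u) (λ i → retained (child u i)) D) (trans (retained-children u) (cong (λ b → d ∸ 𝟙 b) eq))
  ... | true = p u ∷ kids u , All.tabulate parent≢kid ∷ kids-unique u ,
    ((λ { (fwd e) → there (∈-kids⁺ e) ; (bwd (_ , refl)) → here refl }) ,
     (λ { (here refl) → bwd (eq , refl) ; (there n∈) → fwd (∈-kids⁻ u n∈) })) ,
    trans (cong suc (trans (length-enum (child u) (λ i → retained (child u i)) D) (trans (retained-children u) (cong (λ b → d ∸ 𝟙 b) eq))))
      (m+[n∸m]≡n 1≤d)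
    where
    parent≢kid : ∀ {n} → n ∈ kids u → p u ≢ n
    parent≢kid n∈ refl = <-asym (≤-reflexive (sym (height-edge (∈-kids⁻ u n∈)))) (≤-reflexive (sym (height-edge (eq , refl))))

  connected⇒root≡ : ∀ {m n} → EqClosure Edge m n → root m ≡ root n
  connected⇒root≡ ε = refl
  connected⇒root≡ (fwd (r , refl) ◅ rest) = trans (root-parent r) (connected⇒root≡ rest)
  connected⇒root≡ (bwd (r , refl) ◅ rest) = trans (sym (root-parent r)) (connected⇒root≡ rest)

  connected-up : ∀ k w → EqClosure Edge w (iter up k w)
  connected-up zero    w = ε
  connected-up (suc k) w = connected-up k w ◅◅ one (iter up k w)
    where
    one : ∀ v → EqClosure Edge v (up v)
    one v with retained v in eq
    ... | true  = bwd (eq , refl) ◅ ε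
    ... | false = ε

  root≡⇒connected : ∀ m n → root m ≡ root n → EqClosure Edge m n
  root≡⇒connected m n eq = connected-up (m * m) m ◅◅
    EqClosure-sym Edge (subst (EqClosure Edge n) (sym eq) (connected-up (n * n) n))

  -- Computability of the forest and of its components

  module _ (child-C : Computable₂ child) (p-C : Computable₁ p) (ix-C : Computable₁ ix)
    (orphan-C : Computable₁ (λ w → 𝟙 (orphan w))) where

    bereft-C : Computable₂ (λ s u → 𝟙 (bereft s u))
    bereft-C = any-C {P = λ i (s , u , _) → bit (child u i) s} (bit-C (app₂ child-C v₂ v₀) v₁) (const-C D)

    stop-C : Computable₃ (λ n s x → 𝟙 (stop n s x))
    stop-C = ∨-C (<ᵇ-C v₂ v₀) (∨-C (app₁ orphan-C v₂) (∨-C (bit-C v₂ v₁) (not-C (app₂ bereft-C v₁ (app₁ p-C v₂)))))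

    end-C : Computable₂ end
    end-C = iter-C p-C (least-C {P = λ j (n , s , _) → stop n s (iter p j n)}
      (app₃ stop-C v₁ v₂ (iter-C p-C v₀ v₁)) v₀) v₀

    next-C : Computable₂ next
    next-C = if-C (<ᵇ-C end-C v₀) v₁ (insert-C end-C v₁)

    cut-C : Computable₁ (λ w → 𝟙 (cut w))
    cut-C = ∨-C (app₁ orphan-C v₀) (bit-C v₀ (app₁ (cuts-C next-C) (suc-C v₀)))

    rank-C : Computable₁ rank
    rank-C = count-C {P = λ i (w , _) → not (cut (child (p w) i))}
      (not-C (app₁ cut-C (app₂ child-C (app₁ p-C v₁) v₀))) (app₁ ix-C v₀)

    private
      stage : ℕ → ℕ → ℕ → ℕ
      stage w i y = 𝟙 (not (cut (iter p (w * w ∸ i) w)) ∧ (rank (iter p (w * w ∸ i) w) <ᵇ d ∸ y))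

      -- Primitive recursion evaluates retain from the top of the walk downwards.
      stages : ∀ w k → k ≤ suc (w * w) → rec 0 (stage w) k ≡ 𝟙 (retain k (iter p (suc (w * w) ∸ k) w))
      stages w zero    _ = refl
      stages w (suc k) (s≤s k≤) = cong (λ y → 𝟙 (not (cut (iter p (w * w ∸ k) w)) ∧ (rank (iter p (w * w ∸ k) w) <ᵇ d ∸ y)))
        (trans (stages w k (≤-trans k≤ (n≤1+n _))) (cong (λ l → 𝟙 (retain k (iter p l w))) (+-∸-assoc 1 k≤)))

      stage-C : Computable₃ stage
      stage-C = ∧-C (not-C (app₁ cut-C z)) (<ᵇ-C (app₁ rank-C z) (∸-C (const-C d) v₂))
        where
        z : Computable₃ (λ w i y → iter p (w * w ∸ i) w)
        z = iter-C p-C (∸-C (*-C v₀ v₀) v₁) v₀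

    opaque
      unfolding retained

      retained-C : Computable₁ (λ w → 𝟙 (retained w))
      retained-C = cong-C {f = λ e → rec 0 (stage (proj₁ e)) (suc (proj₁ e * proj₁ e))}
        (λ e → trans (stages (proj₁ e) _ ≤-refl)
          (cong (λ l → 𝟙 (retain (suc (proj₁ e * proj₁ e)) (iter p l (proj₁ e)))) (n∸n≡0 (proj₁ e * proj₁ e))))
        (rec-C {s = λ i y e → stage (proj₁ e) i y} zero-C (app₃ stage-C v₂ v₀ v₁) (suc-C (*-C v₀ v₀)))

    root-C : Computable₁ root
    root-C = iter-C (if-C (app₁ retained-C v₀) (app₁ p-C v₀) v₀) (*-C v₀ v₀) v₀

    computable-edge : ComputableRelation Edge
    computable-edge = record
      { decide   = λ m n → map′ (λ t → ∧-conicalˡ _ _ (T⇒true t) , ≡ᵇ-true⁻¹ (p n) m (∧-conicalʳ (retained n) _ (T⇒true t)))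
                                (λ (r , eq) → true⇒T (∧-intro r (≡ᵇ-true (p n) m eq)))
                                (T? (retained n ∧ (p n ≡ᵇ m)))
      ; code     = program edge-C
      ; computes = λ m n → halts edge-C (m , n , tt) }
      where
      edge-C : Computable₂ (λ m n → 𝟙 (retained n ∧ (p n ≡ᵇ m)))
      edge-C = ∧-C (app₁ retained-C v₁) (≡ᵇ-C (app₁ p-C v₁) v₀)

    computable-connected : ComputableRelation (EqClosure Edge)
    computable-connected = record
      { decide   = λ m n → map′ (λ t → root≡⇒connected m n (≡ᵇ-true⁻¹ (root m) (root n) (T⇒true t)))
                                (λ c → true⇒T (≡ᵇ-true (root m) (root n) (connected⇒root≡ c)))
                                (T? (root m ≡ᵇ root n))
      ; code     = program same-C
      ; computes = λ m n → halts same-C (m , n , tt) }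
      where
      same-C : Computable₂ (λ m n → 𝟙 (root m ≡ᵇ root n))
      same-C = ≡ᵇ-C (app₁ root-C v₀) (app₁ root-C v₁)

-- The matching in E ∘ E

does⁻¹ : ∀ {P : Set} (P? : Dec P) → does P? ≡ true → P
does⁻¹ (yes p) _ = p

∈⇒<sum : ∀ {x} xs → x ∈ xs → x < suc (ListAction.sum xs)
∈⇒<sum (y ∷ xs) (here refl) = s≤s (m≤m+n y _)
∈⇒<sum (y ∷ xs) (there x∈) = ≤-trans (∈⇒<sum xs x∈) (s≤s (m≤n+m _ y))

sum-blocks : ∀ f k n → sum f (n * k) ≡ sum (λ u → sum (λ i → f (u * k + i)) k) n
sum-blocks f k zero    = refl
sum-blocks f k (suc n) = trans (cong (sum f) (+-comm k (n * k)))
  (trans (sum-split f (n * k) k) (cong (_+ sum (λ i → f (n * k + i)) k) (sum-blocks f k n)))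

[u*k+i]/k : ∀ u {i k} .{{_ : NonZero k}} → i < k → (u * k + i) / k ≡ u
[u*k+i]/k u {i} {k} i<k = trans (+-distrib-/-∣ˡ {u * k} i (divides-refl u))
  (trans (cong₂ _+_ (m*n/n≡m u k) (m<n⇒m/n≡0 i<k)) (+-identityʳ u))

[u*k+i]%k : ∀ u {i k} .{{_ : NonZero k}} → i < k → (u * k + i) % k ≡ i
[u*k+i]%k u {i} {k} i<k = trans (cong (_% k) (+-comm (u * k) i)) (trans ([m+kn]%n≡m%n i u k) (m<n⇒m%n≡m i<k))

m<[1+m/k]*k : ∀ m k .{{_ : NonZero k}} → m < suc (m / k) * k
m<[1+m/k]*k m k = subst (_< suc (m / k) * k) (sym (m≡m%n+[m/n]*n m k)) (+-monoˡ-< (m / k * k) (m%n<n m k))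

/-C : ∀ k .{{_ : NonZero k}} → Computable₁ (_/ k)
/-C k = minimize-C {P = λ q e → suc q * k ≤ᵇ proj₁ e}
  (≤ᵇ-C (*-C (suc-C v₀) (const-C k)) v₁)
  (λ (a , _) → ¬-not λ q → <⇒≱ (m<[1+m/k]*k a k) (≤ᵇ-true⁻¹ _ a q))
  (λ (a , _) i i<q → ≤ᵇ-true (≤-trans (*-monoˡ-≤ k i<q) (m/n*n≤m a k)))

%-C : ∀ k .{{_ : NonZero k}} → Computable₁ (_% k)
%-C k = cong-C (λ (a , _) → sym (m%n≡m∸m/n*n a k)) (∸-C v₀ (*-C (app₁ (/-C k) v₀) (const-C k)))

module Expanding
  (d : ℕ) (E : Rel ℕ 0ℓ) (E-sym : Symmetric E) (E-hc : HighlyComputable E)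
  (expands : ∀ (F : Pred ℕ 0ℓ) (k : ℕ) → F HasSize k → ∃[ n ] (E [ F ]) HasSize n × (d + 2) * k ≤ n)
  where

  open HighlyComputable E-hc
  open ComputableRelation computable

  D : ℕ
  D = 2 + d

  e : ℕ → ℕ → Bool
  e x y = does (decide x y)

  E⇒e : ∀ {x y} → E x y → e x y ≡ true
  E⇒e {x} {y} = dec-true (decide x y)

  e⇒E : ∀ {x y} → e x y ≡ true → E x y
  e⇒E {x} {y} = does⁻¹ (decide x y)

  e-sym : ∀ {x y} → e x y ≡ true → e y x ≡ true
  e-sym = E⇒e ∘ E-sym ∘ e⇒E

  e-C : Computable₂ (λ x y → 𝟙 (e x y))
  e-C = code by λ (x , y , _) → computes x y

  size-C : Computable₁ size
  size-C = proj₁ size-computable by λ (x , _) → proj₂ size-computable x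

  full : ℕ → ℕ → Bool
  full x y = size x ≤ᵇ count (e x) y

  opaque
    -- The known size of `E[x]` tells when all neighbours have been seen, which gives a computable
    -- strict bound. The list of neighbours only bounds the search here; the program for it uses
    -- `μ`.
    reach : ℕ → ℕ
    reach x = least (full x) (suc (suc (ListAction.sum (proj₁ (size-correct x)))))

    reach-spec : ∀ x → full x (reach x) ≡ true × (∀ i → i < reach x → full x i ≡ false)
    reach-spec x = proj₂ (least-∋ (full x) (suc top) (any-intro (full x) {top} ≤-refl (≤ᵇ-true
        (size≤count (e x) top (size-correct x) λ Exy →
          ∈⇒<sum _ (proj₁ (proj₁ (proj₂ (proj₂ (size-correct x)))) Exy) , E⇒e Exy)))) ,
      λ i lt → least-minimal (full x) (suc top) lt
      where
      top : ℕ
      top = suc (ListAction.sum (proj₁ (size-correct x)))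

  reach-C : Computable₁ reach
  reach-C = minimize-C {P = λ y (x , _) → not (full x y)}
    (not-C (≤ᵇ-C (app₁ size-C v₁) (count-C {P = λ z (y , x , _) → e x z} (app₂ e-C v₂ v₀) v₀)))
    (λ (x , _) → cong not (proj₁ (reach-spec x)))
    (λ (x , _) i lt → not-true (proj₂ (reach-spec x) i lt))

  <-reach : ∀ {x y} → e x y ≡ true → y < reach x
  <-reach {x} {y} exy = ≰⇒> λ le → 1+n≰n (begin
    suc (size x)                ≤⟨ s≤s (≤ᵇ-true⁻¹ _ _ (proj₁ (reach-spec x))) ⟩
    suc (count (e x) (reach x)) ≤⟨ s≤s (sum-monoʳ _ le) ⟩
    suc (count (e x) y)         ≡⟨ trans (+-comm 1 _) (cong (λ b → count (e x) y + 𝟙 b) (sym exy)) ⟩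
    count (e x) (suc y)         ≤⟨ count≤size (e x) (suc y) (size-correct x) (λ _ → e⇒E) ⟩
    size x                      ∎)
    where open ≤-Reasoning

  -- The extra `suc` in each term forces `m ≤ β m`, so that the regions increase.
  β : ℕ → ℕ
  β = sum (suc ∘ reach)

  β-mono : ∀ {m n} → m ≤ n → β m ≤ β n
  β-mono = sum-monoʳ _

  β-bound : ∀ {x y m} → e x y ≡ true → x < m → y < β m
  β-bound exy x<m = ≤-trans (<-reach exy) (≤-trans (n≤1+n _) (term≤sum (suc ∘ reach) x<m))

  m≤βm : ∀ m → m ≤ β m
  m≤βm zero    = z≤n
  m≤βm (suc m) = ≤-trans (≤-reflexive (+-comm 1 m)) (+-mono-≤ (m≤βm m) (s≤s z≤n))

  β-C : Computable₁ β
  β-C = sum-C {f = λ i _ → suc (reach i)} (suc-C (app₁ reach-C v₀)) v₀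

  e² : ℕ → ℕ → Bool
  e² x y = any (λ z → e x z ∧ e z y) (reach x)

  e²-intro : ∀ {x y z} → e x z ≡ true → e z y ≡ true → e² x y ≡ true
  e²-intro {x} {y} exz ezy = any-intro (λ z → e x z ∧ e z y) (<-reach exz) (∧-intro exz ezy)

  e²-elim : ∀ x y → e² x y ≡ true → ∃[ z ] e x z ≡ true × e z y ≡ true
  e²-elim x y q = let (z , _ , r) = any-elim (λ z → e x z ∧ e z y) (reach x) q in
    z , ∧-conicalˡ _ _ r , ∧-conicalʳ (e x z) _ r

  -- Left vertices are copies: u D, …, u D + D - 1 stand for u.
  adj : ℕ → ℕ → Bool
  adj a w = e² (a / D) w

  -- Two applications of `β` follow the two steps along `E`. The factor `D` appears because the
  -- copies of the vertices below k are the numbers below k D.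
  bR bL : ℕ → ℕ
  bR m = β (β m)
  bL m = β (β m) * D

  adj-R : ∀ {a w m} → adj a w ≡ true → a < m → w < bR m
  adj-R {a} {w} {m} q a<m = let (z , q₁ , q₂) = e²-elim (a / D) w q in
    β-bound q₂ (β-bound q₁ (≤-<-trans (m/n≤m a D) a<m))

  adj-L : ∀ {a w m} → adj a w ≡ true → w < m → a < bL m
  adj-L {a} {w} q w<m = let (z , q₁ , q₂) = e²-elim (a / D) w q in
    ≤-trans (m<[1+m/k]*k a D) (*-monoˡ-≤ D (β-bound (e-sym q₁) (β-bound (e-sym q₂) w<m)))

  inflating : ∀ m → m ≤ bL (bR m)
  inflating m = ≤-trans (≤-trans (m≤βm m) (≤-trans (m≤βm _) (≤-trans (m≤βm _) (m≤βm _)))) (m≤m*n _ D)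

  bR-mono : ∀ {m n} → m ≤ n → bR m ≤ bR n
  bR-mono = β-mono ∘ β-mono

  open Hall adj bR bL bR-mono adj-R adj-L inflating

  -- If `base` consists of the vertices with a copy in `A`, then |A| is at most D |base|, while
  -- expanding twice gives at least D² |base| neighbours, and D ≥ 2.
  expansion : ∀ A M → (∀ a → A ∋ a → a < M) → 2 * count A M ≤ count (N A) (bR M)
  expansion A M sup = begin
    2 * count A M             ≤⟨ *-monoʳ-≤ 2 blocks ⟩
    2 * (D * count base M)    ≤⟨ *-monoˡ-≤ (D * count base M) (m≤m+n 2 d) ⟩
    D * (D * count base M)    ≡⟨ cong (λ k → k * (k * count base M)) (+-comm 2 d) ⟩
    (d + 2) * ((d + 2) * count base M) ≤⟨ *-monoʳ-≤ (d + 2) (proj₂ (proj₂ first)) ⟩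
    (d + 2) * proj₁ first     ≤⟨ proj₂ (proj₂ second) ⟩
    proj₁ second              ≤⟨ size≤count (N A) (bR M) (proj₁ (proj₂ second)) (λ {y} → inside {y}) ⟩
    count (N A) (bR M)        ∎
    where
    open ≤-Reasoning
    base : ℕ → Bool
    base u = any (λ i → A (u * D + i)) D
    base-elim : ∀ u → base ∋ u → ∃[ i ] i < D × A ∋ u * D + i
    base-elim u = any-elim (λ i → A (u * D + i)) D
    base-< : ∀ u → base ∋ u → u < M
    base-< u b = let (i , _ , a) = base-elim u b in
      ≤-<-trans (≤-trans (m≤m*n u D) (m≤m+n (u * D) i)) (sup (u * D + i) a)
    first = expands (base ∋_) (count base M) (HasSize-count (base ∋_) base M (λ {u} b → base-< u b , b) (λ _ b → b))
    second = expands (E [ base ∋_ ]) (proj₁ first) (proj₁ (proj₂ first))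
    inside : ∀ {y} → (E [ E [ base ∋_ ] ]) y → y < bR M × N A ∋ y
    inside {y} (z , (u , b , Euz) , Ezy) = let (i , i<D , a) = base-elim u b in
      β-bound (E⇒e Ezy) (β-bound (E⇒e Euz) (base-< u b)) ,
      N-intro A {u * D + i} a (subst (λ v → e² v y ≡ true) (sym ([u*k+i]/k u i<D)) (e²-intro (E⇒e Euz) (E⇒e Ezy)))
    block : ∀ u → count (λ i → A (u * D + i)) D ≤ D * 𝟙 (base u)
    block u with dichotomy (base u)
    ... | inj₁ q rewrite q | *-identityʳ d = count-≤ _ D
    ... | inj₂ q = ≤-trans (≤-reflexive (sum-zero D λ i i<D → cong 𝟙 (any-false (λ i → A (u * D + i)) q i<D))) z≤n
    blocks : count A M ≤ D * count base M
    blocks = ≤-trans (sum-monoʳ (𝟙 ∘ A) (m≤m*n M D)) (≤-trans (≤-reflexive (sum-blocks (𝟙 ∘ A) D M))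
      (≤-trans (sum-mono M λ u _ → block u) (≤-reflexive (sum-* D (𝟙 ∘ base) M))))

  open Matching expansion

  -- Parents and children read off from the matching

  matches : ℕ → ℕ → Bool
  matches w a = match a ≡ᵇ w

  -- The inverse of `match`; the bounded search suffices because every left neighbour of `w` is less
  -- than `bL (suc w)`.
  slot : ℕ → ℕ
  slot w = least (matches w) (bL (suc w))

  orphan : ℕ → Bool
  orphan w = not (any (matches w) (bL (suc w)))

  parent index : ℕ → ℕ
  parent w = slot w / D
  index w = slot w % D

  child : ℕ → ℕ → ℕ
  child u i = match (u * D + i)

  matched : ∀ a → any (matches (match a)) (bL (suc (match a))) ≡ true
  matched a = any-intro (matches (match a)) {a} (adj-L {a} (adj-match a) ≤-refl) (≡ᵇ-true (match a) _ refl)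

  match-slot : ∀ {w} → orphan w ≡ false → match (slot w) ≡ w
  match-slot {w} o = ≡ᵇ-true⁻¹ (match (slot w)) w (proj₂ (least-∋ (matches w) (bL (suc w)) (not-injective o)))

  slot-match : ∀ a → slot (match a) ≡ a
  slot-match a = match-injective (match-slot (cong not (matched a)))

  parent-child : ∀ u {i} → i < D → parent (child u i) ≡ u
  parent-child u {i} i<D = trans (cong (_/ D) (slot-match (u * D + i))) ([u*k+i]/k u i<D)

  index-child : ∀ u {i} → i < D → index (child u i) ≡ i
  index-child u {i} i<D = trans (cong (_% D) (slot-match (u * D + i))) ([u*k+i]%k u i<D)

  child-parent : ∀ w → orphan w ≡ false → child (parent w) (index w) ≡ w
  child-parent w o = trans (cong match (trans (+-comm (slot w / D * D) (slot w % D)) (sym (m≡m%n+[m/n]*n (slot w) D)))) (match-slot o)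

  child-matched : ∀ u {i} → i < D → orphan (child u i) ≡ false
  child-matched u {i} _ = cong not (matched (u * D + i))

  index-< : ∀ w → orphan w ≡ false → index w < D
  index-< w _ = m%n<n (slot w) D

  open Forest d child parent index orphan parent-child index-child child-matched child-parent index-<
    public hiding (D)

  edge⇒E² : ∀ {m n} → Edge m n → ∃[ z ] E m z × E z n
  edge⇒E² {m} {n} (r , refl) =
    let (z , q₁ , q₂) = e²-elim (parent n) n (subst (λ w → adj (slot n) w ≡ true) (match-slot (retained⇒legitimate r)) (adj-match (slot n)))
    in z , e⇒E q₁ , e⇒E q₂

  adj-C : Computable₂ (λ a w → 𝟙 (adj a w))
  adj-C = any-C {P = λ z (a , w , _) → e (a / D) z ∧ e z w}
    (∧-C (app₂ e-C (app₁ (/-C D) v₁) v₀) (app₂ e-C v₀ v₂)) (app₁ reach-C (app₁ (/-C D) v₀))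

  bR-C : Computable₁ bR
  bR-C = app₁ β-C (app₁ β-C v₀)

  bL-C : Computable₁ bL
  bL-C = *-C bR-C (const-C D)

  m-C : Computable₁ match
  m-C = match-C adj-C bR-C bL-C

  matches-C : Computable₂ (λ a w → 𝟙 (matches w a))
  matches-C = ≡ᵇ-C (app₁ m-C v₀) v₁

  slot-C : Computable₁ slot
  slot-C = least-C {P = λ a (w , _) → matches w a} matches-C (app₁ bL-C (suc-C v₀))

  orphan-C : Computable₁ (λ w → 𝟙 (orphan w))
  orphan-C = not-C (any-C {P = λ a (w , _) → matches w a} matches-C (app₁ bL-C (suc-C v₀)))

  child-C : Computable₂ child
  child-C = app₁ m-C (+-C (*-C v₀ (const-C D)) v₁)

theorem1 : ∀ {ℓ : Level} (d : ℕ) → 3 ≤ d →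
    (𝓔 : CoarseStructure ℕ ℓ) → BoundedGeometry 𝓔 → NonAmenable 𝓔 →
    (Σ[ E ∈ Rel ℕ 0ℓ ] CoarseStructure.Entourage 𝓔 E × Symmetric E × HighlyComputable E ×
    (∀ (F : Pred ℕ 0ℓ) (k : ℕ) → F HasSize k →
    ∃[ n ] (E [ F ]) HasSize n × (d + 2) * k ≤ n)) →
    Σ[ E′ ∈ Rel ℕ 0ℓ ] CoarseStructure.Entourage 𝓔 E′ × ComputableRelation E′ ×
    RegularForest d E′ × ComputableRelation (EqClosure E′)
theorem1 d 3≤d 𝓔 _ _ (E , E∈𝓔 , E-sym , E-hc , expands) =
  Edge , subset edge⇒E² (compose E∈𝓔 E∈𝓔) ,
  computable-edge child-C (app₁ (/-C D) slot-C) (app₁ (%-C D) slot-C) orphan-C ,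
  (acyclic , regular (≤-trans (s≤s z≤n) 3≤d)) ,
  computable-connected child-C (app₁ (/-C D) slot-C) (app₁ (%-C D) slot-C) orphan-C
  where
  open CoarseStructure 𝓔
  open Expanding d E E-sym E-hc expands
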